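{- There exists $P_0$ such that for every real $P \ge P_0$ there is a graph $G$ with $\rho(G) \le P$ and $\chi_f(G) > P^2/33$.
   Context: Graphs are finite and simple. For a graph $G$, $v(G)$ is its number of vertices and $\alpha(G)$ is the size of a largest independent set. The Hall ratio of $G$ is $\rho(G) := \max_{\emptyset\neq H\subseteq G} \frac{v(H)}{\alpha(H)}$, the maximum over all subgraphs $H$ of $G$ with at least one vertex. The fractional chromatic number $\chi_f(G)$ is the optimal value of the linear program: minimize $\sum_{I} x_I$ over nonnegative reals $x_I$ indexed by the independent sets $I$ of $G$, subject to $\sum_{I\ni v} x_I\ge 1$ for every vertex $v$. Equivalently, by LP duality, it is the maximum of $\sum_{v\in V(G)} y(v)$ over $y:V(G)\to[0,\infty)$ with $\sum_{v\in I} y(v)\le 1$ for every independent set $I$ of $G$. -}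

module Defs where

open import Data.Bool.Base using (true; false)
open import Data.Fin.Base using (Fin; zero)
open import Data.Fin.Properties using (all?)
open import Data.Fin.Subset using (Subset; ⁅_⁆; ∣_∣; _∈_)
open import Data.Fin.Subset.Properties using (_∈?_; ∣⁅x⁆∣≡1; x∈⁅y⁆⇒x≡y)
import Data.Integer.Base as ℤ
open import Data.List.Base using (List; []; _∷_; _++_; map; foldr; filter)
open import Data.List.Extrema.Nat using (max; xs≤max)
open import Data.List.Membership.Propositional using () renaming (_∈_ to _∈ᴸ_)
open import Data.List.Membership.Propositional.Properties
  using (∈-map⁺; ∈-++⁺ˡ; ∈-++⁺ʳ; ∈-filter⁺)
open import Data.List.Relation.Unary.All using (lookup)
open import Data.List.Relation.Unary.Any using (here)
open import Data.Nat.Base as ℕ using (ℕ; zero; suc)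
import Data.Nat.Properties as ℕₚ
open import Data.Product.Base using (_×_; _,_; proj₁; proj₂; ∃-syntax; Σ-syntax)
open import Data.Rational.Base as ℚ using (ℚ; 0ℚ; 1ℚ; ½)
import Data.Rational.Properties as ℚₚ
open import Data.Rational.Solver using (module +-*-Solver)
open import Data.Vec.Base as Vec using ()
open import Function.Definitions using (Injective)
open import Level using (0ℓ)
open import Relation.Binary.Core using (Rel)
open import Relation.Binary.Definitions using (Symmetric; Irreflexive; Decidable)
open import Relation.Binary.PropositionalEquality
  using (_≡_; refl; sym; trans; cong; subst)
open import Relation.Nullary using (¬_; Dec)
open import Relation.Nullary.Decidable using (_→-dec_; ¬?)

------------------------------------------------------------------------
-- Real numbers: Cauchy sequences of rationals, with equality _≈_

EventuallyWithin : (ℕ → ℚ) → ℚ → Set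
EventuallyWithin a ε = ∃[ N ] ∀ m n → N ℕ.≤ m → N ℕ.≤ n → ℚ.∣ a m ℚ.- a n ∣ ℚ.≤ ε

Cauchy : (ℕ → ℚ) → Set
Cauchy a = ∀ ε → 0ℚ ℚ.< ε → EventuallyWithin a ε

record ℝ : Set where
  no-eta-equality
  field
    seq    : ℕ → ℚ
    cauchy : Cauchy seq

open ℝ public

infix 4 _≤_ _<_ _≈_

_≤_ : Rel ℝ 0ℓ
x ≤ y = ∀ ε → 0ℚ ℚ.< ε → ∃[ N ] ∀ n → N ℕ.≤ n → seq x n ℚ.≤ seq y n ℚ.+ ε

_<_ : Rel ℝ 0ℓ
x < y = ∃[ ε ] (0ℚ ℚ.< ε × ∃[ N ] ∀ n → N ℕ.≤ n → seq x n ℚ.+ ε ℚ.≤ seq y n)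

_≈_ : Rel ℝ 0ℓ
x ≈ y = x ≤ y × y ≤ x

const-cauchy : ∀ q → Cauchy (λ _ → q)
const-cauchy q ε 0<ε = 0 , λ _ _ _ _ →
  subst (ℚ._≤ ε) (sym (cong ℚ.∣_∣ (ℚₚ.+-inverseʳ q))) (ℚₚ.<⇒≤ 0<ε)

+-cauchy : ∀ a b → Cauchy a → Cauchy b → Cauchy (λ n → a n ℚ.+ b n)
+-cauchy a b ca cb ε 0<ε = N ℕ.⊔ M , bound
  where
  δ = ½ ℚ.* ε

  0<δ : 0ℚ ℚ.< δ
  0<δ = subst (ℚ._< δ) (ℚₚ.*-zeroʳ ½) (ℚₚ.*-monoʳ-<-pos ½ 0<ε)

  N = proj₁ (ca δ 0<δ)
  M = proj₁ (cb δ 0<δ)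

  regroup : ∀ p q r s → (p ℚ.+ q) ℚ.- (r ℚ.+ s) ≡ (p ℚ.- r) ℚ.+ (q ℚ.- s)
  regroup = solve 4 (λ p q r s → (p :+ q) :- (r :+ s) := (p :- r) :+ (q :- s)) refl
    where open +-*-Solver

  δ+δ≡ε : δ ℚ.+ δ ≡ ε
  δ+δ≡ε = trans (sym (ℚₚ.*-distribʳ-+ ε ½ ½)) (ℚₚ.*-identityˡ ε)

  bound : ∀ m n → N ℕ.⊔ M ℕ.≤ m → N ℕ.⊔ M ℕ.≤ n →
          ℚ.∣ (a m ℚ.+ b m) ℚ.- (a n ℚ.+ b n) ∣ ℚ.≤ ε
  bound m n ≤m ≤n = begin
    ℚ.∣ (a m ℚ.+ b m) ℚ.- (a n ℚ.+ b n) ∣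
      ≡⟨ cong ℚ.∣_∣ (regroup (a m) (b m) (a n) (b n)) ⟩
    ℚ.∣ (a m ℚ.- a n) ℚ.+ (b m ℚ.- b n) ∣
      ≤⟨ ℚₚ.∣p+q∣≤∣p∣+∣q∣ (a m ℚ.- a n) (b m ℚ.- b n) ⟩
    ℚ.∣ a m ℚ.- a n ∣ ℚ.+ ℚ.∣ b m ℚ.- b n ∣
      ≤⟨ ℚₚ.+-mono-≤
           (proj₂ (ca δ 0<δ) m n (ℕₚ.m⊔n≤o⇒m≤o N M ≤m) (ℕₚ.m⊔n≤o⇒m≤o N M ≤n))
           (proj₂ (cb δ 0<δ) m n (ℕₚ.m⊔n≤o⇒n≤o N M ≤m) (ℕₚ.m⊔n≤o⇒n≤o N M ≤n)) ⟩
    δ ℚ.+ δ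
      ≡⟨ δ+δ≡ε ⟩
    ε ∎
    where open ℚₚ.≤-Reasoning

EventuallyBounded : (ℕ → ℚ) → Set
EventuallyBounded a =
  ∃[ B ] (0ℚ ℚ.< B × ∃[ N ] ∀ n → N ℕ.≤ n → ℚ.∣ a n ∣ ℚ.≤ B)

cauchy-bounded : ∀ {a} → Cauchy a → EventuallyBounded a
cauchy-bounded {a} ca = B , 0<B , N , bound
  where
  0<1 : 0ℚ ℚ.< 1ℚ
  0<1 = ℚₚ.positive⁻¹ 1ℚ

  N = proj₁ (ca 1ℚ 0<1)
  B = 1ℚ ℚ.+ ℚ.∣ a N ∣

  0<B : 0ℚ ℚ.< B
  0<B = ℚₚ.+-mono-<-≤ 0<1 (ℚₚ.0≤∣p∣ (a N))

  split : ∀ p q → p ≡ (p ℚ.- q) ℚ.+ q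
  split = solve 2 (λ p q → p := (p :- q) :+ q) refl
    where open +-*-Solver

  bound : ∀ n → N ℕ.≤ n → ℚ.∣ a n ∣ ℚ.≤ B
  bound n N≤n = begin
    ℚ.∣ a n ∣                          ≡⟨ cong ℚ.∣_∣ (split (a n) (a N)) ⟩
    ℚ.∣ (a n ℚ.- a N) ℚ.+ a N ∣        ≤⟨ ℚₚ.∣p+q∣≤∣p∣+∣q∣ (a n ℚ.- a N) (a N) ⟩
    ℚ.∣ a n ℚ.- a N ∣ ℚ.+ ℚ.∣ a N ∣    ≤⟨ ℚₚ.+-monoˡ-≤ ℚ.∣ a N ∣
                                            (proj₂ (ca 1ℚ 0<1) n N N≤n ℕₚ.≤-refl) ⟩
    B                                  ∎
    where open ℚₚ.≤-Reasoning

∃-divide : ∀ C ε → 0ℚ ℚ.< C → 0ℚ ℚ.< ε → ∃[ δ ] (0ℚ ℚ.< δ × C ℚ.* δ ≡ ε)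
∃-divide C ε 0<C 0<ε = δ , 0<δ , Cδ≡ε
  where
  instance
    C-pos : ℚ.Positive C
    C-pos = ℚ.positive 0<C

    C-nonZero : ℚ.NonZero C
    C-nonZero = ℚₚ.pos⇒nonZero C

  δ = ℚ.1/ C ℚ.* ε

  0<δ : 0ℚ ℚ.< δ
  0<δ = subst (ℚ._< δ) (ℚₚ.*-zeroʳ (ℚ.1/ C))
    (ℚₚ.*-monoʳ-<-pos (ℚ.1/ C) {{ℚₚ.1/pos⇒pos C}} 0<ε)

  Cδ≡ε : C ℚ.* δ ≡ ε
  Cδ≡ε = trans (sym (ℚₚ.*-assoc C (ℚ.1/ C) ε))
    (trans (cong (ℚ._* ε) (ℚₚ.*-inverseʳ C)) (ℚₚ.*-identityˡ ε))

∣*∣-mono : ∀ {p q} r s → 0ℚ ℚ.≤ q →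
  ℚ.∣ r ∣ ℚ.≤ p → ℚ.∣ s ∣ ℚ.≤ q → ℚ.∣ r ℚ.* s ∣ ℚ.≤ p ℚ.* q
∣*∣-mono {p} {q} r s 0≤q r≤p s≤q = begin
  ℚ.∣ r ℚ.* s ∣          ≡⟨ ℚₚ.∣p*q∣≡∣p∣*∣q∣ r s ⟩
  ℚ.∣ r ∣ ℚ.* ℚ.∣ s ∣    ≤⟨ ℚₚ.*-monoˡ-≤-nonNeg ℚ.∣ r ∣ {{ℚₚ.∣-∣-nonNeg r}} s≤q ⟩
  ℚ.∣ r ∣ ℚ.* q          ≤⟨ ℚₚ.*-monoʳ-≤-nonNeg q {{ℚ.nonNegative 0≤q}} r≤p ⟩
  p ℚ.* q                ∎
  where open ℚₚ.≤-Reasoning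

∣pq-rs∣≤ : ∀ {A B δ} p q r s → 0ℚ ℚ.≤ B → 0ℚ ℚ.≤ δ →
  ℚ.∣ p ∣ ℚ.≤ A → ℚ.∣ q ℚ.- s ∣ ℚ.≤ δ → ℚ.∣ p ℚ.- r ∣ ℚ.≤ δ → ℚ.∣ s ∣ ℚ.≤ B →
  ℚ.∣ p ℚ.* q ℚ.- r ℚ.* s ∣ ℚ.≤ (A ℚ.+ B) ℚ.* δ
∣pq-rs∣≤ {A} {B} {δ} p q r s 0≤B 0≤δ p≤A q-s≤δ p-r≤δ s≤B = begin
  ℚ.∣ p ℚ.* q ℚ.- r ℚ.* s ∣
    ≡⟨ cong ℚ.∣_∣ (regroup p q r s) ⟩
  ℚ.∣ p ℚ.* (q ℚ.- s) ℚ.+ (p ℚ.- r) ℚ.* s ∣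
    ≤⟨ ℚₚ.∣p+q∣≤∣p∣+∣q∣ (p ℚ.* (q ℚ.- s)) ((p ℚ.- r) ℚ.* s) ⟩
  ℚ.∣ p ℚ.* (q ℚ.- s) ∣ ℚ.+ ℚ.∣ (p ℚ.- r) ℚ.* s ∣
    ≤⟨ ℚₚ.+-mono-≤ (∣*∣-mono p (q ℚ.- s) 0≤δ p≤A q-s≤δ)
                   (∣*∣-mono (p ℚ.- r) s 0≤B p-r≤δ s≤B) ⟩
  A ℚ.* δ ℚ.+ δ ℚ.* B
    ≡⟨ cong (A ℚ.* δ ℚ.+_) (ℚₚ.*-comm δ B) ⟩
  A ℚ.* δ ℚ.+ B ℚ.* δ
    ≡⟨ ℚₚ.*-distribʳ-+ δ A B ⟨
  (A ℚ.+ B) ℚ.* δ ∎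
  where
  open ℚₚ.≤-Reasoning

  regroup : ∀ p q r s →
    p ℚ.* q ℚ.- r ℚ.* s ≡ p ℚ.* (q ℚ.- s) ℚ.+ (p ℚ.- r) ℚ.* s
  regroup = solve 4 (λ p q r s →
    p :* q :- r :* s := p :* (q :- s) :+ (p :- r) :* s) refl
    where open +-*-Solver

*-eventuallyWithin : ∀ a b ε δ
  ((A , _) : EventuallyBounded a) ((B , _) : EventuallyBounded b) →
  0ℚ ℚ.< δ → (A ℚ.+ B) ℚ.* δ ≡ ε →
  EventuallyWithin a δ → EventuallyWithin b δ → EventuallyWithin (λ n → a n ℚ.* b n) ε
*-eventuallyWithin a b ε δ (A , 0<A , K , ∣a∣≤A) (B , 0<B , L , ∣b∣≤B) 0<δ Cδ≡ε
  (N , a-close) (M , b-close) = R , bound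
  where
  R = (K ℕ.⊔ L) ℕ.⊔ (N ℕ.⊔ M)

  K≤ : ∀ i → R ℕ.≤ i → K ℕ.≤ i
  K≤ i R≤i = ℕₚ.m⊔n≤o⇒m≤o K L (ℕₚ.m⊔n≤o⇒m≤o (K ℕ.⊔ L) (N ℕ.⊔ M) R≤i)

  L≤ : ∀ i → R ℕ.≤ i → L ℕ.≤ i
  L≤ i R≤i = ℕₚ.m⊔n≤o⇒n≤o K L (ℕₚ.m⊔n≤o⇒m≤o (K ℕ.⊔ L) (N ℕ.⊔ M) R≤i)

  N≤ : ∀ i → R ℕ.≤ i → N ℕ.≤ i
  N≤ i R≤i = ℕₚ.m⊔n≤o⇒m≤o N M (ℕₚ.m⊔n≤o⇒n≤o (K ℕ.⊔ L) (N ℕ.⊔ M) R≤i)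

  M≤ : ∀ i → R ℕ.≤ i → M ℕ.≤ i
  M≤ i R≤i = ℕₚ.m⊔n≤o⇒n≤o N M (ℕₚ.m⊔n≤o⇒n≤o (K ℕ.⊔ L) (N ℕ.⊔ M) R≤i)

  bound : ∀ m n → R ℕ.≤ m → R ℕ.≤ n → ℚ.∣ a m ℚ.* b m ℚ.- a n ℚ.* b n ∣ ℚ.≤ ε
  bound m n R≤m R≤n = subst (ℚ.∣ a m ℚ.* b m ℚ.- a n ℚ.* b n ∣ ℚ.≤_) Cδ≡ε
    (∣pq-rs∣≤ (a m) (b m) (a n) (b n) (ℚₚ.<⇒≤ 0<B) (ℚₚ.<⇒≤ 0<δ)
      (∣a∣≤A m (K≤ m R≤m))
      (b-close m n (M≤ m R≤m) (M≤ n R≤n))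
      (a-close m n (N≤ m R≤m) (N≤ n R≤n))
      (∣b∣≤B n (L≤ n R≤n)))

*-cauchy : ∀ a b → Cauchy a → Cauchy b → Cauchy (λ n → a n ℚ.* b n)
*-cauchy a b ca cb ε 0<ε = conv (cauchy-bounded ca) (cauchy-bounded cb)
  where
  conv : EventuallyBounded a → EventuallyBounded b → EventuallyWithin (λ n → a n ℚ.* b n) ε
  conv ba@(A , 0<A , _) bb@(B , 0<B , _) =
    finish (∃-divide (A ℚ.+ B) ε (ℚₚ.+-mono-< 0<A 0<B) 0<ε)
    where
    finish : ∃[ δ ] (0ℚ ℚ.< δ × (A ℚ.+ B) ℚ.* δ ≡ ε) →
             EventuallyWithin (λ n → a n ℚ.* b n) ε
    finish (δ , 0<δ , Cδ≡ε) =
      *-eventuallyWithin a b ε δ ba bb 0<δ Cδ≡ε (ca δ 0<δ) (cb δ 0<δ)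

infixl 7 _*_ _/_
infixl 6 _+_
infix  8 _²

fromℚ : ℚ → ℝ
fromℚ q .seq _  = q
fromℚ q .cauchy = const-cauchy q

0ℝ 1ℝ : ℝ
0ℝ = fromℚ 0ℚ
1ℝ = fromℚ 1ℚ

_+_ : ℝ → ℝ → ℝ
(x + y) .seq n  = seq x n ℚ.+ seq y n
(x + y) .cauchy = +-cauchy (seq x) (seq y) (cauchy x) (cauchy y)

_*_ : ℝ → ℝ → ℝ
(x * y) .seq n  = seq x n ℚ.* seq y n
(x * y) .cauchy = *-cauchy (seq x) (seq y) (cauchy x) (cauchy y)

_² : ℝ → ℝ
x ² = x * x

_/_ : ℝ → (n : ℕ) .{{_ : ℕ.NonZero n}} → ℝ
x / n = x * fromℚ (ℤ.+ 1 ℚ./ n)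

∑ : {A : Set} → List A → (A → ℝ) → ℝ
∑ xs f = foldr _+_ 0ℝ (map f xs)

------------------------------------------------------------------------
-- Finite simple graphs

record Graph : Set₁ where
  field
    v      : ℕ
    _~_    : Rel (Fin v) 0ℓ
    ~-sym  : Symmetric _~_
    ~-irr  : Irreflexive _≡_ _~_
    _~?_   : Decidable _~_

open Graph public using (v)

-- H ⊆ G: H is, up to renaming its vertices, a (not necessarily induced)
-- subgraph of G.
record _⊆_ (H G : Graph) : Set where
  private
    module H = Graph H
    module G = Graph G
  field
    embed      : Fin H.v → Fin G.v
    injective  : Injective _≡_ _≡_ embed
    edges      : ∀ {x y} → x H.~ y → embed x G.~ embed y

allSubsets : ∀ n → List (Subset n)
allSubsets zero    = Vec.[] ∷ []
allSubsets (suc n) = map (false Vec.∷_) (allSubsets n) ++ map (true Vec.∷_) (allSubsets n)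

∈-allSubsets : ∀ {n} (S : Subset n) → S ∈ᴸ allSubsets n
∈-allSubsets Vec.[]            = here refl
∈-allSubsets (false Vec.∷ S) = ∈-++⁺ˡ (∈-map⁺ (false Vec.∷_) (∈-allSubsets S))
∈-allSubsets {suc n} (true Vec.∷ S) =
  ∈-++⁺ʳ (map (false Vec.∷_) (allSubsets n)) (∈-map⁺ (true Vec.∷_) (∈-allSubsets S))

module _ (G : Graph) where
  open Graph G using (_~_; ~-irr; _~?_)

  Independent : Subset (v G) → Set
  Independent S = ∀ x y → x ∈ S → y ∈ S → ¬ (x ~ y)

  independent? : ∀ S → Dec (Independent S)
  independent? S = all? λ x → all? λ y →
    (x ∈? S) →-dec ((y ∈? S) →-dec ¬? (x ~? y))

  independentSets : List (Subset (v G))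
  independentSets = filter independent? (allSubsets (v G))

  -- The default value 0 is the size of the independent set ∅.
  α : ℕ
  α = max 0 (map ∣_∣ independentSets)

  ∣independent∣≤α : ∀ {S} → Independent S → ∣ S ∣ ℕ.≤ α
  ∣independent∣≤α {S} ind = lookup (xs≤max 0 (map ∣_∣ independentSets))
    (∈-map⁺ ∣_∣ (∈-filter⁺ independent? (∈-allSubsets S) ind))

  singleton-independent : ∀ x → Independent ⁅ x ⁆
  singleton-independent x y z y∈ z∈ =
    ~-irr (trans (x∈⁅y⁆⇒x≡y x y∈) (sym (x∈⁅y⁆⇒x≡y x z∈)))

  1≤α : Fin (v G) → 1 ℕ.≤ α
  1≤α x = subst (ℕ._≤ α) (∣⁅x⁆∣≡1 x) (∣independent∣≤α (singleton-independent x))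

α-nonZero : ∀ G → .{{_ : ℕ.NonZero (v G)}} → ℕ.NonZero (α G)
α-nonZero G@record { v = suc _ } = ℕ.>-nonZero (1≤α G zero)

v/α : (H : Graph) .{{_ : ℕ.NonZero (v H)}} → ℚ
v/α H = (ℤ.+ v H ℚ./ α H) {{α-nonZero H}}

-- ρ(G) = r: r is the maximum of v(H)/α(H) over the subgraphs H of G having
-- at least one vertex.  (No r qualifies if G has no vertices.)
record IsHallRatio (G : Graph) (r : ℚ) : Set₁ where
  field
    attained : ∃[ H ] Σ[ ne ∈ ℕ.NonZero (v H) ] (H ⊆ G × v/α H {{ne}} ≡ r)
    maximal  : ∀ H .{{_ : ℕ.NonZero (v H)}} → H ⊆ G → v/α H ℚ.≤ r

-- A function x on sets of vertices; only its values at independent sets matter.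
IsFractionalColouring : (G : Graph) → (Subset (v G) → ℝ) → Set
IsFractionalColouring G x =
  (∀ I → Independent G I → 0ℝ ≤ x I) ×
  (∀ u → 1ℝ ≤ ∑ (filter (u ∈?_) (independentSets G)) x)

weight : (G : Graph) → (Subset (v G) → ℝ) → ℝ
weight G x = ∑ (independentSets G) x

-- χ_f(G) = c
IsFractionalChromaticNumber : Graph → ℝ → Set
IsFractionalChromaticNumber G c =
  (∃[ x ] (IsFractionalColouring G x × weight G x ≈ c)) ×
  (∀ x → IsFractionalColouring G x → c ≤ weight G x)

{-# OPTIONS --safe #-}
module Submission where

-- Call x, y ∈ {0,1}ⁿ adjacent if they agree in fewer than t coordinates.  An
-- independent set I then satisfies an isoperimetric inequality (any two of its
-- points agree in at least t coordinates), so for t of order √n it has density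
-- at most 1/m, while every bounded set of vertices is 2-coloured by a coordinate
-- in which all its edges differ.  A smallest nonempty S such that m ∣I∣ ≤ ∣S∣ for
-- all independent I ⊆ S has Hall ratio at most m, and the weights m/∣S∣ on S show
-- that its fractional chromatic number is at least m.  Join k such graphs, each
-- locally bipartite on a scale exceeding the total size of the previous ones:
-- fractional chromatic numbers add up to km, whereas for a subgraph with
-- independence number a only one of the k graphs can contribute more than 2a
-- vertices without the smaller ones being negligible, so the Hall ratio is at
-- most m + 1 + 2k.  For m = k this is k² against 3k + 1, and k² > (3k + 6)²/33.

open import Defs
open import Data.Nat.Base using (nonZero)
open import Data.Product.Base using (_×_; ∃-syntax)

open import Algebra.Bundles using (CommutativeRing)
open import Data.Bool.Base using (Bool; true; false; if_then_else_; _∧_)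
import Data.Bool.Properties as Boolₚ
open import Data.Empty using (⊥-elim)
open import Data.Fin.Base using (Fin; zero; suc; _↑ˡ_; _↑ʳ_; splitAt)
open import Data.Fin.Properties as Finₚ using (all?; any?; injective⇒≤; splitAt-↑ˡ; splitAt-↑ʳ)
open import Data.Fin.Subset
  using (Subset; ∣_∣; _∈_; _∉_; _∩_; _∪_; ∁; ⊥; ⊤; _-_; ⁅_⁆; Empty; Nonempty)
  renaming (_⊆_ to _⊑_)
open import Data.Fin.Subset.Properties
import Data.Integer.Base as ℤ
import Data.Integer.Properties as ℤₚ
open import Data.Integer.Tactic.RingSolver using () renaming (solve-∀ to ℤ-solve-∀)
open import Data.List.Base as List
  using (List; []; _∷_; allFin; cartesianProductWith; concatMap; filter; foldr; length; map; upTo)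
open import Data.List.Extrema.Nat using (max≤v⁺)
open import Data.List.Membership.Propositional using (lose) renaming (_∈_ to _∈ᴸ_)
open import Data.List.Membership.Propositional.Properties
  using (∈-allFin; ∈-cartesianProductWith⁺; ∈-cartesianProductWith⁻; ∈-concatMap⁺; ∈-filter⁺; ∈-filter⁻;
         ∈-map⁺; ∈-map⁻; ∈-tabulate⁺; ∈-tabulate⁻; ∈-upTo⁺)
  renaming (∈-++⁺ˡ to ∈ᴸ-++⁺ˡ; ∈-++⁺ʳ to ∈ᴸ-++⁺ʳ; ∈-++⁻ to ∈ᴸ-++⁻)
open import Data.List.Relation.Unary.All as All using (All)
import Data.List.Relation.Unary.All.Properties as Allₚ
open import Data.List.Relation.Unary.AllPairs using ([]; _∷_)
open import Data.List.Relation.Unary.Any using (here; there)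
open import Data.List.Relation.Unary.Unique.Propositional using (Unique)
import Data.List.Relation.Unary.Unique.Propositional.Properties as Uniqueₚ
open import Data.Nat.Base as ℕ using (ℕ; zero; suc; z≤n; s≤s; _^_)
open import Data.Nat.Induction using (<-wellFounded)
import Data.Nat.Properties as ℕₚ
open import Data.Nat.Tactic.RingSolver using (solve-∀)
open import Data.Product.Base using (_,_; proj₁; proj₂)
open import Data.Rational.Base as ℚ using (ℚ; 0ℚ; 1ℚ; mkℚ)
import Data.Rational.Properties as ℚₚ
open import Data.Rational.Solver using (module +-*-Solver)
open import Data.Rational.Unnormalised.Base as ℚᵘ using (mkℚᵘ)
import Data.Rational.Unnormalised.Properties as ℚᵘₚ
open import Data.Sum.Base using (_⊎_; inj₁; inj₂; [_,_]; [_,_]′)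
open import Data.Unit.Base using (tt) renaming (⊤ to Unit)
open import Data.Vec.Base as Vec using (Vec; []; _∷_; _++_; here; lookup; tabulate; there; zipWith)
open import Data.Vec.Properties
  using (≡-dec; []=⇒lookup; lookup-++ˡ; lookup-++ʳ; lookup-map; lookup-zipWith; lookup⇒[]=;
         lookup∘tabulate; zipWith-comm; ∷-injectiveʳ)
open import Function.Base using (_∘_; id)
open import Function.Definitions using (Injective)
open import Induction.WellFounded using (Acc; acc)
open import Relation.Binary.Definitions using (DecidableEquality)
open import Relation.Binary.PropositionalEquality
  using (_≡_; _≢_; refl; sym; trans; cong; cong₂; subst; subst₂; module ≡-Reasoning)
open import Relation.Nullary using (¬_; Dec; yes; no)
open import Relation.Nullary.Decidable using (¬?; dec-true; does; _×-dec_; _→-dec_)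

open import Algebra.Properties.CommutativeMonoid.Sum ℚₚ.+-0-commutativeMonoid
  using (sum; sum-cong-≗; ∑-distrib-+)
open import Algebra.Properties.Semiring.Sum (CommutativeRing.semiring ℚₚ.+-*-commutativeRing)
  using (*-distribˡ-sum)

-- For q = s / (s + 1) the base (1 + q)² / 4q of the isoperimetric bound equals 1 + 1 / 4s(s + 1).
-- Dimension n = s(s + 1) therefore keeps its n-th power bounded, while t = s c makes qᵗ about e⁻ᶜ:
-- a constant c fixes the density, and s remains free to push t / n below any given scale. The cube
-- may still have subgraphs of Hall ratio above m. Minimality of S is what makes the upper bound for
-- the Hall ratio and the lower bound for χ_f meet at the same m, and local bipartiteness survives
-- the passage to S. Asymptotically, k² against (3k + 1)² would allow any constant above 9. The
-- value 33 pays, from k = 3 on, for the gaps of length 3 between the numbers 3k + 1 and for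
-- replacing P by a rational number within 2 of it. Both invariants have to be exhibited exactly: ρ
-- as a maximum over a finite list of induced subgraphs, χ_f as the optimum of a rational linear
-- program that stays optimal among real colourings.

-- Inequalities for the induction over coordinates

-- (Y ∸ p) (Y ∸ q) ≥ 0, expanded
p+q-bound : ∀ {p q Y} → p ℕ.≤ Y → q ℕ.≤ Y → (p ℕ.+ q) ℕ.* Y ℕ.≤ Y ℕ.* Y ℕ.+ p ℕ.* q
p+q-bound {p} {q} {Y} p≤Y q≤Y = begin
  (p ℕ.+ q) ℕ.* Y                              ≡⟨ cong (λ z → (p ℕ.+ q) ℕ.* z) p+d≡Y ⟨
  (p ℕ.+ q) ℕ.* (p ℕ.+ d)                      ≡⟨ expand₁ p q d ⟩
  p ℕ.* (p ℕ.+ d) ℕ.+ q ℕ.* d ℕ.+ p ℕ.* q      ≤⟨ ℕₚ.+-monoˡ-≤ (p ℕ.* q) (ℕₚ.+-monoʳ-≤ (p ℕ.* (p ℕ.+ d)) (ℕₚ.*-monoˡ-≤ d q≤p+d)) ⟩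
  p ℕ.* (p ℕ.+ d) ℕ.+ (p ℕ.+ d) ℕ.* d ℕ.+ p ℕ.* q ≡⟨ expand₂ p q d ⟩
  (p ℕ.+ d) ℕ.* (p ℕ.+ d) ℕ.+ p ℕ.* q          ≡⟨ cong (λ z → z ℕ.* z ℕ.+ p ℕ.* q) p+d≡Y ⟩
  Y ℕ.* Y ℕ.+ p ℕ.* q                          ∎
  where
  open ℕₚ.≤-Reasoning
  d = Y ℕ.∸ p
  p+d≡Y : p ℕ.+ d ≡ Y
  p+d≡Y = ℕₚ.m+[n∸m]≡n p≤Y
  q≤p+d = subst (q ℕ.≤_) (sym p+d≡Y) q≤Y
  expand₁ : ∀ p q d → (p ℕ.+ q) ℕ.* (p ℕ.+ d) ≡ p ℕ.* (p ℕ.+ d) ℕ.+ q ℕ.* d ℕ.+ p ℕ.* q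
  expand₁ = solve-∀
  expand₂ : ∀ p q d → p ℕ.* (p ℕ.+ d) ℕ.+ (p ℕ.+ d) ℕ.* d ℕ.+ p ℕ.* q ≡ (p ℕ.+ d) ℕ.* (p ℕ.+ d) ℕ.+ p ℕ.* q
  expand₂ = solve-∀

-- Let θ = s / (s + 1). Here `p` and `q` stand for pairs with equal first bits, `u` and `w` for
-- pairs with different ones, which gain a factor θ. As `p q = u w`, the preceding inequality gives
-- p + q ≤ R + u w / R ≤ (1 + θ²) R, and u + w ≤ 2θ R; the sum is at most (1 + θ)² R.
slices-bound : ∀ s {p q u w R} → p ℕ.≤ R → q ℕ.≤ R →
  suc s ℕ.* u ℕ.≤ s ℕ.* R → suc s ℕ.* w ℕ.≤ s ℕ.* R → p ℕ.* q ≡ u ℕ.* w →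
  (p ℕ.+ q ℕ.+ (u ℕ.+ w)) ℕ.* (suc s ℕ.* suc s) ℕ.≤ R ℕ.* ((s ℕ.+ suc s) ℕ.* (s ℕ.+ suc s))
-- The general case cancels a factor `R`; for `R = 0` the last two bounds force `u` and `w` to
-- vanish.
slices-bound s {zero} {zero} {u} {w} {zero} _ _ su≤ sw≤ _ = ℕₚ.≤-trans
  (ℕₚ.≤-reflexive (shape s u w))
  (ℕₚ.≤-trans (ℕₚ.*-monoʳ-≤ (suc s) (ℕₚ.+-mono-≤ su≤ sw≤)) (ℕₚ.≤-reflexive (vanish s)))
  where
  shape : ∀ s u w → (u ℕ.+ w) ℕ.* (suc s ℕ.* suc s) ≡ suc s ℕ.* (suc s ℕ.* u ℕ.+ suc s ℕ.* w)
  shape = solve-∀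
  vanish : ∀ s → suc s ℕ.* (s ℕ.* 0 ℕ.+ s ℕ.* 0) ≡ 0
  vanish = solve-∀
slices-bound s {p} {q} {u} {w} {R@(suc _)} p≤R q≤R su≤ sw≤ pq≡uw = ℕₚ.*-cancelʳ-≤ _ _ R (begin
  (p ℕ.+ q ℕ.+ (u ℕ.+ w)) ℕ.* (suc s ℕ.* suc s) ℕ.* R
    ≡⟨ shape₁ s p q u w R ⟩
  suc s ℕ.* suc s ℕ.* ((p ℕ.+ q) ℕ.* R) ℕ.+ suc s ℕ.* R ℕ.* (suc s ℕ.* u ℕ.+ suc s ℕ.* w)
    ≤⟨ ℕₚ.+-mono-≤ (ℕₚ.*-monoʳ-≤ (suc s ℕ.* suc s) (p+q-bound p≤R q≤R))
                   (ℕₚ.*-monoʳ-≤ (suc s ℕ.* R) (ℕₚ.+-mono-≤ su≤ sw≤)) ⟩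
  suc s ℕ.* suc s ℕ.* (R ℕ.* R ℕ.+ p ℕ.* q) ℕ.+ suc s ℕ.* R ℕ.* (s ℕ.* R ℕ.+ s ℕ.* R)
    ≡⟨ cong (λ z → suc s ℕ.* suc s ℕ.* (R ℕ.* R ℕ.+ z) ℕ.+ suc s ℕ.* R ℕ.* (s ℕ.* R ℕ.+ s ℕ.* R)) pq≡uw ⟩
  suc s ℕ.* suc s ℕ.* (R ℕ.* R ℕ.+ u ℕ.* w) ℕ.+ suc s ℕ.* R ℕ.* (s ℕ.* R ℕ.+ s ℕ.* R)
    ≡⟨ shape₂ s u w R ⟩
  suc s ℕ.* suc s ℕ.* (R ℕ.* R) ℕ.+ suc s ℕ.* u ℕ.* (suc s ℕ.* w) ℕ.+ suc s ℕ.* R ℕ.* (s ℕ.* R ℕ.+ s ℕ.* R)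
    ≤⟨ ℕₚ.+-monoˡ-≤ _ (ℕₚ.+-monoʳ-≤ (suc s ℕ.* suc s ℕ.* (R ℕ.* R)) (ℕₚ.*-mono-≤ su≤ sw≤)) ⟩
  suc s ℕ.* suc s ℕ.* (R ℕ.* R) ℕ.+ s ℕ.* R ℕ.* (s ℕ.* R) ℕ.+ suc s ℕ.* R ℕ.* (s ℕ.* R ℕ.+ s ℕ.* R)
    ≡⟨ shape₃ s R ⟩
  R ℕ.* ((s ℕ.+ suc s) ℕ.* (s ℕ.+ suc s)) ℕ.* R ∎)
  where
  open ℕₚ.≤-Reasoning
  shape₁ : ∀ s p q u w R → (p ℕ.+ q ℕ.+ (u ℕ.+ w)) ℕ.* (suc s ℕ.* suc s) ℕ.* R ≡
    suc s ℕ.* suc s ℕ.* ((p ℕ.+ q) ℕ.* R) ℕ.+ suc s ℕ.* R ℕ.* (suc s ℕ.* u ℕ.+ suc s ℕ.* w)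
  shape₁ = solve-∀
  shape₂ : ∀ s u w R →
    suc s ℕ.* suc s ℕ.* (R ℕ.* R ℕ.+ u ℕ.* w) ℕ.+ suc s ℕ.* R ℕ.* (s ℕ.* R ℕ.+ s ℕ.* R) ≡
    suc s ℕ.* suc s ℕ.* (R ℕ.* R) ℕ.+ suc s ℕ.* u ℕ.* (suc s ℕ.* w) ℕ.+ suc s ℕ.* R ℕ.* (s ℕ.* R ℕ.+ s ℕ.* R)
  shape₂ = solve-∀
  shape₃ : ∀ s R →
    suc s ℕ.* suc s ℕ.* (R ℕ.* R) ℕ.+ s ℕ.* R ℕ.* (s ℕ.* R) ℕ.+ suc s ℕ.* R ℕ.* (s ℕ.* R ℕ.+ s ℕ.* R) ≡
    R ℕ.* ((s ℕ.+ suc s) ℕ.* (s ℕ.+ suc s)) ℕ.* R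
  shape₃ = solve-∀

-- The isoperimetric inequality

∣++∣ : ∀ {a b} (A : Subset a) (B : Subset b) → ∣ A ++ B ∣ ≡ ∣ A ∣ ℕ.+ ∣ B ∣
∣++∣ []          B = refl
∣++∣ (true  ∷ A) B = cong suc (∣++∣ A B)
∣++∣ (false ∷ A) B = ∣++∣ A B

∈-++⁺ˡ : ∀ {a b} {A : Subset a} {B : Subset b} {x} → x ∈ A → (x ↑ˡ b) ∈ (A ++ B)
∈-++⁺ˡ here      = here
∈-++⁺ˡ (there p) = there (∈-++⁺ˡ p)

∈-++⁺ʳ : ∀ {a b} (A : Subset a) {B : Subset b} {x} → x ∈ B → (a ↑ʳ x) ∈ (A ++ B)
∈-++⁺ʳ []      p = p
∈-++⁺ʳ (_ ∷ A) p = there (∈-++⁺ʳ A p)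

data ∈-++-View {a b} (A : Subset a) (B : Subset b) : Fin (a ℕ.+ b) → Set where
  left  : ∀ {x} → x ∈ A → ∈-++-View A B (x ↑ˡ b)
  right : ∀ {x} → x ∈ B → ∈-++-View A B (a ↑ʳ x)

∈-++⁻ : ∀ {a b} (A : Subset a) {B : Subset b} {x} → x ∈ (A ++ B) → ∈-++-View A B x
∈-++⁻ []      p         = right p
∈-++⁻ (_ ∷ A) here      = left here
∈-++⁻ (_ ∷ A) (there p) with ∈-++⁻ A p
... | left  q = left (there q)
... | right q = right q

-- Defined by doubling rather than as `2 ^ n`, so that a subset of `Fin (2^ suc n)` splits
-- definitionally into two halves, one for each first bit.
2^_ : ℕ → ℕ
2^ zero  = 1
2^ suc n = 2^ n ℕ.+ 2^ n

bits : ∀ n → Fin (2^ n) → Vec Bool n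
bits zero    _ = []
bits (suc n) x = [ (λ y → false ∷ bits n y) , (λ y → true ∷ bits n y) ]′ (splitAt (2^ n) x)

bits-↑ˡ : ∀ n x → bits (suc n) (x ↑ˡ 2^ n) ≡ false ∷ bits n x
bits-↑ˡ n x = cong [ _ , _ ]′ (splitAt-↑ˡ (2^ n) x (2^ n))

bits-↑ʳ : ∀ n x → bits (suc n) (2^ n ↑ʳ x) ≡ true ∷ bits n x
bits-↑ʳ n x = cong [ _ , _ ]′ (splitAt-↑ʳ (2^ n) (2^ n) x)

agreement : ∀ {n} → Vec Bool n → Vec Bool n → Subset n
agreement = zipWith (λ a b → does (a Boolₚ.≟ b))

-- ∣ A ∣ ∣ B ∣ ≤ 4ⁿ qᵗ ((1 + q)² / 4q)ⁿ for q = s / (s + 1), with denominators cleared.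
isoperimetry : ∀ s n t (A B : Subset (2^ n)) →
  (∀ {x y} → x ∈ A → y ∈ B → t ℕ.≤ ∣ agreement (bits n x) (bits n y) ∣) →
  ∣ A ∣ ℕ.* ∣ B ∣ ℕ.* (suc s ^ t ℕ.* (s ℕ.* suc s) ^ n) ℕ.≤
  s ^ t ℕ.* ((s ℕ.+ suc s) ℕ.* (s ℕ.+ suc s)) ^ n
isoperimetry s n zero A B _ = begin
  ∣ A ∣ ℕ.* ∣ B ∣ ℕ.* (1 ℕ.* (s ℕ.* suc s) ^ n)
    ≤⟨ ℕₚ.*-mono-≤ (ℕₚ.*-mono-≤ (∣p∣≤n A) (∣p∣≤n B)) (ℕₚ.≤-reflexive (ℕₚ.*-identityˡ _)) ⟩
  2^ n ℕ.* 2^ n ℕ.* (s ℕ.* suc s) ^ n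
    ≤⟨ power-bound n ⟩
  ((s ℕ.+ suc s) ℕ.* (s ℕ.+ suc s)) ^ n
    ≡⟨ ℕₚ.*-identityˡ _ ⟨
  1 ℕ.* ((s ℕ.+ suc s) ℕ.* (s ℕ.+ suc s)) ^ n ∎
  where
  open ℕₚ.≤-Reasoning
  Q = (s ℕ.+ suc s) ℕ.* (s ℕ.+ suc s)
  4s[s+1]≤Q : 4 ℕ.* (s ℕ.* suc s) ℕ.≤ Q
  4s[s+1]≤Q = subst (4 ℕ.* (s ℕ.* suc s) ℕ.≤_) (square s) (ℕₚ.n≤1+n _)
    where
    square : ∀ s → suc (4 ℕ.* (s ℕ.* suc s)) ≡ (s ℕ.+ suc s) ℕ.* (s ℕ.+ suc s)
    square = solve-∀
  power-bound : ∀ n → 2^ n ℕ.* 2^ n ℕ.* (s ℕ.* suc s) ^ n ℕ.≤ Q ^ n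
  power-bound zero    = ℕₚ.≤-refl
  power-bound (suc n) = begin
    (2^ n ℕ.+ 2^ n) ℕ.* (2^ n ℕ.+ 2^ n) ℕ.* (s ℕ.* suc s ℕ.* (s ℕ.* suc s) ^ n)
      ≡⟨ shape (2^ n) (s ℕ.* suc s) ((s ℕ.* suc s) ^ n) ⟩
    4 ℕ.* (s ℕ.* suc s) ℕ.* (2^ n ℕ.* 2^ n ℕ.* (s ℕ.* suc s) ^ n)
      ≤⟨ ℕₚ.*-mono-≤ 4s[s+1]≤Q (power-bound n) ⟩
    Q ℕ.* Q ^ n ∎
    where
    shape : ∀ a b c → (a ℕ.+ a) ℕ.* (a ℕ.+ a) ℕ.* (b ℕ.* c) ≡ 4 ℕ.* b ℕ.* (a ℕ.* a ℕ.* c)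
    shape = solve-∀
isoperimetry s zero (suc t) (true ∷ []) (true ∷ []) apart with () ← apart here here
isoperimetry s zero (suc t) (false ∷ []) B apart = z≤n
isoperimetry s zero (suc t) (true ∷ []) (false ∷ []) apart = z≤n
isoperimetry s (suc n) (suc t) A B apart
  with A₀ , A₁ , refl ← Vec.splitAt (2^ n) A | B₀ , B₁ , refl ← Vec.splitAt (2^ n) B = begin
  ∣ A₀ ++ A₁ ∣ ℕ.* ∣ B₀ ++ B₁ ∣ ℕ.* (suc s ℕ.* suc s ^ t ℕ.* (s ℕ.* suc s ℕ.* (s ℕ.* suc s) ^ n))
    ≡⟨ cong₂ (λ a b → a ℕ.* b ℕ.* (suc s ℕ.* suc s ^ t ℕ.* (s ℕ.* suc s ℕ.* (s ℕ.* suc s) ^ n)))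
         (∣++∣ A₀ A₁) (∣++∣ B₀ B₁) ⟩
  (a₀ ℕ.+ a₁) ℕ.* (b₀ ℕ.+ b₁) ℕ.* (suc s ℕ.* suc s ^ t ℕ.* (s ℕ.* suc s ℕ.* (s ℕ.* suc s) ^ n))
    ≡⟨ shape₁ s a₀ a₁ b₀ b₁ (suc s ^ t) ((s ℕ.* suc s) ^ n) ⟩
  s ℕ.* ((a₀ ℕ.* b₀ ℕ.* W ℕ.+ a₁ ℕ.* b₁ ℕ.* W ℕ.+ (a₀ ℕ.* b₁ ℕ.* W ℕ.+ a₁ ℕ.* b₀ ℕ.* W)) ℕ.* (suc s ℕ.* suc s))
    -- Equal first bits use up one agreement, so like halves satisfy the hypothesis for `t`. Unlike
    -- halves keep `suc t`, which is where the factor s / (s + 1) comes from. They also force the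
    -- induction to run over two sets `A` and `B`.
    ≤⟨ ℕₚ.*-monoʳ-≤ s (slices-bound s
         (isoperimetry s n t A₀ B₀ λ {x} {y} p q → ℕ.s≤s⁻¹
           (subst₂ (λ i j → suc t ℕ.≤ ∣ agreement i j ∣) (bits-↑ˡ n x) (bits-↑ˡ n y)
             (apart (∈-++⁺ˡ p) (∈-++⁺ˡ q))))
         (isoperimetry s n t A₁ B₁ λ {x} {y} p q → ℕ.s≤s⁻¹
           (subst₂ (λ i j → suc t ℕ.≤ ∣ agreement i j ∣) (bits-↑ʳ n x) (bits-↑ʳ n y)
             (apart (∈-++⁺ʳ A₀ p) (∈-++⁺ʳ B₀ q))))
         (mixed a₀ b₁ (isoperimetry s n (suc t) A₀ B₁ λ {x} {y} p q →
           subst₂ (λ i j → suc t ℕ.≤ ∣ agreement i j ∣) (bits-↑ˡ n x) (bits-↑ʳ n y)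
             (apart (∈-++⁺ˡ p) (∈-++⁺ʳ B₀ q))))
         (mixed a₁ b₀ (isoperimetry s n (suc t) A₁ B₀ λ {x} {y} p q →
           subst₂ (λ i j → suc t ℕ.≤ ∣ agreement i j ∣) (bits-↑ʳ n x) (bits-↑ˡ n y)
             (apart (∈-++⁺ʳ A₀ p) (∈-++⁺ˡ q))))
         (shape₃ a₀ a₁ b₀ b₁ W)) ⟩
  s ℕ.* (s ^ t ℕ.* Q ^ n ℕ.* Q)
    ≡⟨ shape₂ s (s ^ t) (Q ^ n) Q ⟩
  s ℕ.* s ^ t ℕ.* (Q ℕ.* Q ^ n) ∎
  where
  open ℕₚ.≤-Reasoning
  a₀ = ∣ A₀ ∣
  a₁ = ∣ A₁ ∣
  b₀ = ∣ B₀ ∣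
  b₁ = ∣ B₁ ∣
  W  = suc s ^ t ℕ.* (s ℕ.* suc s) ^ n
  Q  = (s ℕ.+ suc s) ℕ.* (s ℕ.+ suc s)
  shape₁ : ∀ s a₀ a₁ b₀ b₁ x y →
    (a₀ ℕ.+ a₁) ℕ.* (b₀ ℕ.+ b₁) ℕ.* (suc s ℕ.* x ℕ.* (s ℕ.* suc s ℕ.* y)) ≡
    s ℕ.* ((a₀ ℕ.* b₀ ℕ.* (x ℕ.* y) ℕ.+ a₁ ℕ.* b₁ ℕ.* (x ℕ.* y) ℕ.+
           (a₀ ℕ.* b₁ ℕ.* (x ℕ.* y) ℕ.+ a₁ ℕ.* b₀ ℕ.* (x ℕ.* y))) ℕ.* (suc s ℕ.* suc s))
  shape₁ = solve-∀
  shape₂ : ∀ s x y Q → s ℕ.* (x ℕ.* y ℕ.* Q) ≡ s ℕ.* x ℕ.* (Q ℕ.* y)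
  shape₂ = solve-∀
  shape₃ : ∀ a₀ a₁ b₀ b₁ W → a₀ ℕ.* b₀ ℕ.* W ℕ.* (a₁ ℕ.* b₁ ℕ.* W) ≡ a₀ ℕ.* b₁ ℕ.* W ℕ.* (a₁ ℕ.* b₀ ℕ.* W)
  shape₃ = solve-∀
  mixed : ∀ a b →
    a ℕ.* b ℕ.* (suc s ℕ.* suc s ^ t ℕ.* (s ℕ.* suc s) ^ n) ℕ.≤ s ℕ.* s ^ t ℕ.* Q ^ n →
    suc s ℕ.* (a ℕ.* b ℕ.* W) ℕ.≤ s ℕ.* (s ^ t ℕ.* Q ^ n)
  mixed a b = subst₂ ℕ._≤_ (shape a b s (suc s ^ t) ((s ℕ.* suc s) ^ n)) (ℕₚ.*-assoc s (s ^ t) (Q ^ n))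
    where
    shape : ∀ a b s x y → a ℕ.* b ℕ.* (suc s ℕ.* x ℕ.* y) ≡ suc s ℕ.* (a ℕ.* b ℕ.* (x ℕ.* y))
    shape = solve-∀

-- Numerical estimates and the density of independent sets

bernoulli : ∀ s j → (s ℕ.+ j) ℕ.* s ^ j ℕ.≤ s ℕ.* suc s ^ j
bernoulli s zero    = ℕₚ.≤-reflexive (cong (ℕ._* 1) (ℕₚ.+-identityʳ s))
bernoulli s (suc j) = begin
  (s ℕ.+ suc j) ℕ.* (s ℕ.* s ^ j)               ≤⟨ ℕₚ.m≤m+n _ (j ℕ.* s ^ j) ⟩
  (s ℕ.+ suc j) ℕ.* (s ℕ.* s ^ j) ℕ.+ j ℕ.* s ^ j ≡⟨ shape₁ s j (s ^ j) ⟩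
  suc s ℕ.* ((s ℕ.+ j) ℕ.* s ^ j)               ≤⟨ ℕₚ.*-monoʳ-≤ (suc s) (bernoulli s j) ⟩
  suc s ℕ.* (s ℕ.* suc s ^ j)                   ≡⟨ shape₂ s (suc s ^ j) ⟩
  s ℕ.* (suc s ℕ.* suc s ^ j)                   ∎
  where
  open ℕₚ.≤-Reasoning
  shape₁ : ∀ s j x → (s ℕ.+ suc j) ℕ.* (s ℕ.* x) ℕ.+ j ℕ.* x ≡ suc s ℕ.* ((s ℕ.+ j) ℕ.* x)
  shape₁ = solve-∀
  shape₂ : ∀ s x → suc s ℕ.* (s ℕ.* x) ≡ s ℕ.* (suc s ℕ.* x)
  shape₂ = solve-∀

2sˢ≤[1+s]ˢ : ∀ s .{{_ : ℕ.NonZero s}} → 2 ℕ.* s ^ s ℕ.≤ suc s ^ s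
2sˢ≤[1+s]ˢ s = ℕₚ.*-cancelˡ-≤ s (subst (ℕ._≤ s ℕ.* suc s ^ s) (shape s (s ^ s)) (bernoulli s s))
  where
  shape : ∀ s x → (s ℕ.+ s) ℕ.* x ≡ s ℕ.* (2 ℕ.* x)
  shape = solve-∀

-- (1 + 1/M)ʲ ≤ (r + j) / r whenever r + j ≤ M
[1+M]ʲ-bound : ∀ M j r → r ℕ.+ j ℕ.≤ M → suc M ^ j ℕ.* r ℕ.≤ M ^ j ℕ.* (r ℕ.+ j)
[1+M]ʲ-bound M zero    r _     = ℕₚ.*-monoʳ-≤ 1 (ℕₚ.m≤m+n r 0)
[1+M]ʲ-bound M (suc j) r r+j≤M = begin
  suc M ℕ.* suc M ^ j ℕ.* r            ≡⟨ shape₁ M (suc M ^ j) r ⟩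
  -- As r ≤ M, the factor 1 + 1 / M is at most (r + 1) / r, and these quotients telescope.
  suc M ^ j ℕ.* (r ℕ.+ M ℕ.* r)        ≤⟨ ℕₚ.*-monoʳ-≤ (suc M ^ j) (ℕₚ.+-monoˡ-≤ (M ℕ.* r) (ℕₚ.m+n≤o⇒m≤o r r+j≤M)) ⟩
  suc M ^ j ℕ.* (M ℕ.+ M ℕ.* r)        ≡⟨ shape₂ M (suc M ^ j) r ⟩
  M ℕ.* (suc M ^ j ℕ.* suc r)          ≤⟨ ℕₚ.*-monoʳ-≤ M ([1+M]ʲ-bound M j (suc r) (subst (ℕ._≤ M) (ℕₚ.+-suc r j) r+j≤M)) ⟩
  M ℕ.* (M ^ j ℕ.* (suc r ℕ.+ j))      ≡⟨ cong (λ z → M ℕ.* (M ^ j ℕ.* z)) (ℕₚ.+-suc r j) ⟨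
  M ℕ.* (M ^ j ℕ.* (r ℕ.+ suc j))      ≡⟨ ℕₚ.*-assoc M (M ^ j) (r ℕ.+ suc j) ⟨
  M ℕ.* M ^ j ℕ.* (r ℕ.+ suc j)        ∎
  where
  open ℕₚ.≤-Reasoning
  shape₁ : ∀ M x r → suc M ℕ.* x ℕ.* r ≡ x ℕ.* (r ℕ.+ M ℕ.* r)
  shape₁ = solve-∀
  shape₂ : ∀ M x r → x ℕ.* (M ℕ.+ M ℕ.* r) ≡ M ℕ.* (x ℕ.* suc r)
  shape₂ = solve-∀

-- Taking r = 3N above bounds (1 + 1 / 4N)ᴺ by 4 / 3, hence by 2.
[1+4N]ᴺ-bound : ∀ N .{{_ : ℕ.NonZero N}} → suc (4 ℕ.* N) ^ N ℕ.≤ 2 ℕ.* (4 ℕ.* N) ^ N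
[1+4N]ᴺ-bound N = ℕₚ.*-cancelʳ-≤ _ _ (3 ℕ.* N) {{ℕₚ.m*n≢0 3 N}} (begin
  suc (4 ℕ.* N) ^ N ℕ.* (3 ℕ.* N)          ≤⟨ [1+M]ʲ-bound (4 ℕ.* N) N (3 ℕ.* N) (ℕₚ.≤-reflexive (shape₁ N)) ⟩
  (4 ℕ.* N) ^ N ℕ.* (3 ℕ.* N ℕ.+ N)        ≤⟨ ℕₚ.m≤m+n _ ((4 ℕ.* N) ^ N ℕ.* (2 ℕ.* N)) ⟩
  (4 ℕ.* N) ^ N ℕ.* (3 ℕ.* N ℕ.+ N) ℕ.+ (4 ℕ.* N) ^ N ℕ.* (2 ℕ.* N) ≡⟨ shape₂ N ((4 ℕ.* N) ^ N) ⟩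
  2 ℕ.* (4 ℕ.* N) ^ N ℕ.* (3 ℕ.* N)        ∎)
  where
  open ℕₚ.≤-Reasoning
  shape₁ : ∀ N → 3 ℕ.* N ℕ.+ N ≡ 4 ℕ.* N
  shape₁ = solve-∀
  shape₂ : ∀ N x → x ℕ.* (3 ℕ.* N ℕ.+ N) ℕ.+ x ℕ.* (2 ℕ.* N) ≡ 2 ℕ.* x ℕ.* (3 ℕ.* N)
  shape₂ = solve-∀

square-cancel-≤ : ∀ {x y} → x ℕ.* x ℕ.≤ y ℕ.* y → x ℕ.≤ y
square-cancel-≤ {x} {y} xx≤yy with x ℕₚ.≤? y
... | yes x≤y = x≤y
... | no  x≰y = ⊥-elim (ℕₚ.<⇒≱ (ℕₚ.*-mono-< (ℕₚ.≰⇒> x≰y) (ℕₚ.≰⇒> x≰y)) xx≤yy)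

2^≡^ : ∀ n → 2^ n ≡ 2 ^ n
2^≡^ zero    = refl
2^≡^ (suc n) = trans (cong₂ ℕ._+_ (2^≡^ n) (2^≡^ n)) (cong (2 ^ n ℕ.+_) (sym (ℕₚ.+-identityʳ (2 ^ n))))

m≤2^m : ∀ m → m ℕ.≤ 2 ^ m
m≤2^m zero    = z≤n
m≤2^m (suc m) = ℕₚ.+-mono-≤ (ℕₚ.m^n>0 2 m) (ℕₚ.≤-trans (m≤2^m m) (ℕₚ.m≤m+n (2 ^ m) 0))

^-distribʳ-* : ∀ m n o → (m ℕ.* n) ^ o ≡ m ^ o ℕ.* n ^ o
^-distribʳ-* m n zero    = refl
^-distribʳ-* m n (suc o) = trans (cong (m ℕ.* n ℕ.*_) (^-distribʳ-* m n o)) (shape m n (m ^ o) (n ^ o))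
  where
  shape : ∀ m n x y → m ℕ.* n ℕ.* (x ℕ.* y) ≡ m ℕ.* x ℕ.* (n ℕ.* y)
  shape = solve-∀

-- Isoperimetry for the pair `I`, `I` gives ∣I∣² ≤ 4ᴺ · 2 · 2⁻ᶜ: each block of `s` agreements costs
-- a factor 2, and `[1+4N]ᴺ-bound` contributes the single 2. With c = 2m + 1 the odd unit pays for
-- that 2, leaving 2ᵐ ∣I∣ ≤ 2ᴺ.
small-if-agreeing : ∀ s m .{{_ : ℕ.NonZero s}} (I : Subset (2^ (s ℕ.* suc s))) →
  (∀ {x y} → x ∈ I → y ∈ I →
    s ℕ.* suc (2 ℕ.* m) ℕ.≤ ∣ agreement (bits (s ℕ.* suc s) x) (bits (s ℕ.* suc s) y) ∣) →
  m ℕ.* ∣ I ∣ ℕ.≤ 2^ (s ℕ.* suc s)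
small-if-agreeing s m I agreeing = begin
  m ℕ.* a          ≤⟨ ℕₚ.*-monoˡ-≤ a (m≤2^m m) ⟩
  2 ^ m ℕ.* a      ≤⟨ square-cancel-≤ (ℕₚ.*-cancelˡ-≤ 2 (ℕₚ.*-cancelˡ-≤ (X ℕ.* Y) {{XY≢0}} main)) ⟩
  2 ^ N            ≡⟨ 2^≡^ N ⟨
  2^ N             ∎
  where
  open ℕₚ.≤-Reasoning
  N = s ℕ.* suc s
  c = suc (2 ℕ.* m)
  a = ∣ I ∣
  X = s ^ (s ℕ.* c)
  Y = N ^ N
  Q = (s ℕ.+ suc s) ℕ.* (s ℕ.+ suc s)
  N≢0 : ℕ.NonZero N
  N≢0 = ℕₚ.m*n≢0 s (suc s)
  XY≢0 : ℕ.NonZero (X ℕ.* Y)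
  XY≢0 = ℕₚ.m*n≢0 X Y {{ℕₚ.m^n≢0 s (s ℕ.* c)}} {{ℕₚ.m^n≢0 N N {{N≢0}}}}

  2ᶜX≤ : 2 ^ c ℕ.* X ℕ.≤ suc s ^ (s ℕ.* c)
  2ᶜX≤ = begin
    2 ^ c ℕ.* s ^ (s ℕ.* c)  ≡⟨ cong (2 ^ c ℕ.*_) (ℕₚ.^-*-assoc s s c) ⟨
    2 ^ c ℕ.* (s ^ s) ^ c    ≡⟨ ^-distribʳ-* 2 (s ^ s) c ⟨
    (2 ℕ.* s ^ s) ^ c        ≤⟨ ℕₚ.^-monoˡ-≤ c (2sˢ≤[1+s]ˢ s) ⟩
    (suc s ^ s) ^ c          ≡⟨ ℕₚ.^-*-assoc (suc s) s c ⟩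
    suc s ^ (s ℕ.* c)        ∎

  Qᴺ≤ : Q ^ N ℕ.≤ 2 ℕ.* (2 ^ N ℕ.* 2 ^ N ℕ.* Y)
  Qᴺ≤ = begin
    Q ^ N                              ≡⟨ cong (_^ N) (square s) ⟩
    suc (4 ℕ.* N) ^ N                  ≤⟨ [1+4N]ᴺ-bound N {{N≢0}} ⟩
    2 ℕ.* (4 ℕ.* N) ^ N                ≡⟨ cong (2 ℕ.*_) (^-distribʳ-* 4 N N) ⟩
    2 ℕ.* (4 ^ N ℕ.* Y)                ≡⟨ cong (λ z → 2 ℕ.* (z ℕ.* Y)) (^-distribʳ-* 2 2 N) ⟩
    2 ℕ.* (2 ^ N ℕ.* 2 ^ N ℕ.* Y)      ∎
    where
    square : ∀ s → (s ℕ.+ suc s) ℕ.* (s ℕ.+ suc s) ≡ suc (4 ℕ.* (s ℕ.* suc s))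
    square = solve-∀

  2ᶜ≡ : 2 ^ c ≡ 2 ℕ.* (2 ^ m ℕ.* 2 ^ m)
  2ᶜ≡ = cong (2 ℕ.*_) (trans (cong (2 ^_) (cong (m ℕ.+_) (ℕₚ.+-identityʳ m))) (ℕₚ.^-distribˡ-+-* 2 m m))

  shape₁ : ∀ X Y b a → X ℕ.* Y ℕ.* (2 ℕ.* (b ℕ.* a ℕ.* (b ℕ.* a))) ≡ a ℕ.* a ℕ.* (2 ℕ.* (b ℕ.* b) ℕ.* X ℕ.* Y)
  shape₁ = solve-∀
  shape₂ : ∀ X Y d → X ℕ.* (2 ℕ.* (d ℕ.* d ℕ.* Y)) ≡ X ℕ.* Y ℕ.* (2 ℕ.* (d ℕ.* d))
  shape₂ = solve-∀

  main : X ℕ.* Y ℕ.* (2 ℕ.* (2 ^ m ℕ.* a ℕ.* (2 ^ m ℕ.* a))) ℕ.≤ X ℕ.* Y ℕ.* (2 ℕ.* (2 ^ N ℕ.* 2 ^ N))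
  main = begin
    X ℕ.* Y ℕ.* (2 ℕ.* (2 ^ m ℕ.* a ℕ.* (2 ^ m ℕ.* a)))  ≡⟨ shape₁ X Y (2 ^ m) a ⟩
    a ℕ.* a ℕ.* (2 ℕ.* (2 ^ m ℕ.* 2 ^ m) ℕ.* X ℕ.* Y)    ≡⟨ cong (λ z → a ℕ.* a ℕ.* (z ℕ.* X ℕ.* Y)) 2ᶜ≡ ⟨
    a ℕ.* a ℕ.* (2 ^ c ℕ.* X ℕ.* Y)                      ≤⟨ ℕₚ.*-monoʳ-≤ (a ℕ.* a) (ℕₚ.*-monoˡ-≤ Y 2ᶜX≤) ⟩
    a ℕ.* a ℕ.* (suc s ^ (s ℕ.* c) ℕ.* Y)                ≤⟨ isoperimetry s N (s ℕ.* c) I I agreeing ⟩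
    X ℕ.* Q ^ N                                          ≤⟨ ℕₚ.*-monoʳ-≤ X Qᴺ≤ ⟩
    X ℕ.* (2 ℕ.* (2 ^ N ℕ.* 2 ^ N ℕ.* Y))                ≡⟨ shape₂ X Y (2 ^ N) ⟩
    X ℕ.* Y ℕ.* (2 ℕ.* (2 ^ N ℕ.* 2 ^ N))                ∎

-- The hypercube graphs

agreement-comm : ∀ {n} (x y : Vec Bool n) → agreement x y ≡ agreement y x
agreement-comm = zipWith-comm λ where
  false false → refl
  false true  → refl
  true  false → refl
  true  true  → refl

∣agreement-refl∣ : ∀ {n} (x : Vec Bool n) → ∣ agreement x x ∣ ≡ n
∣agreement-refl∣ []          = refl
∣agreement-refl∣ (false ∷ x) = cong suc (∣agreement-refl∣ x)
∣agreement-refl∣ (true  ∷ x) = cong suc (∣agreement-refl∣ x)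

∈-agreement : ∀ {n} (x y : Vec Bool n) {c} → lookup x c ≡ lookup y c → c ∈ agreement x y
∈-agreement (false ∷ _) (false ∷ _) {zero}  _  = here
∈-agreement (true  ∷ _) (true  ∷ _) {zero}  _  = here
∈-agreement (_ ∷ x)     (_ ∷ y)     {suc c} eq = there (∈-agreement x y eq)

cube : ∀ n t → t ℕ.≤ n → Graph
cube n t t≤n = record
  { v     = 2^ n
  ; _~_   = λ x y → ∣ agreement (bits n x) (bits n y) ∣ ℕ.< t
  ; ~-sym = λ {x} {y} → subst (λ z → ∣ z ∣ ℕ.< t) (agreement-comm (bits n x) (bits n y))
  ; ~-irr = λ { {x} refl x~x → ℕₚ.<⇒≱ x~x (subst (t ℕ.≤_) (sym (∣agreement-refl∣ (bits n x))) t≤n) }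
  ; _~?_  = λ x y → _ ℕₚ.<? t
  }

∣p∪q∣≤∣p∣+∣q∣ : ∀ {n} (p q : Subset n) → ∣ p ∪ q ∣ ℕ.≤ ∣ p ∣ ℕ.+ ∣ q ∣
∣p∪q∣≤∣p∣+∣q∣ []          []          = z≤n
∣p∪q∣≤∣p∣+∣q∣ (false ∷ p) (false ∷ q) = ∣p∪q∣≤∣p∣+∣q∣ p q
∣p∪q∣≤∣p∣+∣q∣ (false ∷ p) (true  ∷ q) =
  ℕₚ.≤-trans (s≤s (∣p∪q∣≤∣p∣+∣q∣ p q)) (ℕₚ.≤-reflexive (sym (ℕₚ.+-suc ∣ p ∣ ∣ q ∣)))
∣p∪q∣≤∣p∣+∣q∣ (true  ∷ p) (false ∷ q) = s≤s (∣p∪q∣≤∣p∣+∣q∣ p q)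
∣p∪q∣≤∣p∣+∣q∣ (true  ∷ p) (true  ∷ q) =
  s≤s (ℕₚ.≤-trans (∣p∪q∣≤∣p∣+∣q∣ p q) (ℕₚ.+-monoʳ-≤ ∣ p ∣ (ℕₚ.n≤1+n ∣ q ∣)))

⋃[_]_ : ∀ {n k} → Subset n → (Fin n → Subset k) → Subset k
⋃[ []        ] f = ⊥
⋃[ true  ∷ T ] f = f zero ∪ (⋃[ T ] (f ∘ suc))
⋃[ false ∷ T ] f = ⋃[ T ] (f ∘ suc)

∣⋃∣≤ : ∀ {n k} (T : Subset n) (f : Fin n → Subset k) {b} → (∀ x → ∣ f x ∣ ℕ.≤ b) → ∣ ⋃[ T ] f ∣ ℕ.≤ ∣ T ∣ ℕ.* b
∣⋃∣≤ {k = k} [] f f≤b = ℕₚ.≤-reflexive (∣⊥∣≡0 k)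
∣⋃∣≤ (true  ∷ T) f f≤b =
  ℕₚ.≤-trans (∣p∪q∣≤∣p∣+∣q∣ (f zero) _) (ℕₚ.+-mono-≤ (f≤b zero) (∣⋃∣≤ T (f ∘ suc) (f≤b ∘ suc)))
∣⋃∣≤ (false ∷ T) f f≤b = ∣⋃∣≤ T (f ∘ suc) (f≤b ∘ suc)

∈-⋃ : ∀ {n k} {T : Subset n} (f : Fin n → Subset k) {x c} → x ∈ T → c ∈ f x → c ∈ ⋃[ T ] f
∈-⋃ {T = true  ∷ T} f here        c∈ = x∈p∪q⁺ (inj₁ c∈)
∈-⋃ {T = true  ∷ T} f (there x∈T) c∈ = x∈p∪q⁺ (inj₂ (∈-⋃ (f ∘ suc) x∈T c∈))
∈-⋃ {T = false ∷ T} f (there x∈T) c∈ = ∈-⋃ (f ∘ suc) x∈T c∈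

∣p∣<n⇒∃∉ : ∀ {n} (p : Subset n) → ∣ p ∣ ℕ.< n → ∃[ x ] (x ∉ p)
∣p∣<n⇒∃∉ (false ∷ p) _ = zero , λ ()
∣p∣<n⇒∃∉ (true  ∷ p) (s≤s lt) with x , x∉p ← ∣p∣<n⇒∃∉ p lt = suc x , x∉p ∘ drop-there

∣p∣≤∣p∩q∣+∣p∩∁q∣ : ∀ {n} (p q : Subset n) → ∣ p ∣ ℕ.≤ ∣ p ∩ q ∣ ℕ.+ ∣ p ∩ ∁ q ∣
∣p∣≤∣p∩q∣+∣p∩∁q∣ []          []          = z≤n
∣p∣≤∣p∩q∣+∣p∩∁q∣ (false ∷ p) (_     ∷ q) = ∣p∣≤∣p∩q∣+∣p∩∁q∣ p q
∣p∣≤∣p∩q∣+∣p∩∁q∣ (true  ∷ p) (true  ∷ q) = s≤s (∣p∣≤∣p∩q∣+∣p∩∁q∣ p q)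
∣p∣≤∣p∩q∣+∣p∩∁q∣ (true  ∷ p) (false ∷ q) =
  ℕₚ.≤-trans (s≤s (∣p∣≤∣p∩q∣+∣p∩∁q∣ p q)) (ℕₚ.≤-reflexive (sym (ℕₚ.+-suc ∣ p ∩ q ∣ _)))

-- If every `T` has such a part, all induced subgraphs have v / α at most `r`. Since deleting edges
-- can only increase α, this bounds the Hall ratio, and vertex subsets can stand for subgraphs until
-- the end.
record IndependentPart (r : ℕ) (G : Graph) (T : Subset (v G)) : Set where
  constructor part
  field
    {set}       : Subset (v G)
    ⊑T          : set ⊑ T
    independent : Independent G set
    large       : ∣ T ∣ ℕ.≤ r ℕ.* ∣ set ∣

-- T spans at most ∣ T ∣² edges, each with fewer than t agreeing coordinates, so in
-- some coordinate the two ends of every edge differ; it is a 2-colouring of T.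
module _ n t (t≤n : t ℕ.≤ n) (T : Subset (2^ n)) (small : ∣ T ∣ ℕ.* (∣ T ∣ ℕ.* t) ℕ.< n) where
  private
    open Graph (cube n t t≤n) using (_~_; _~?_)

    bad : Fin (2^ n) → Fin (2^ n) → Subset n
    bad x y with x ~? y
    ... | yes _ = agreement (bits n x) (bits n y)
    ... | no  _ = ⊥

    ∣bad∣≤t : ∀ x y → ∣ bad x y ∣ ℕ.≤ t
    ∣bad∣≤t x y with x ~? y
    ... | yes x~y = ℕₚ.<⇒≤ x~y
    ... | no  _   = ℕₚ.≤-trans (ℕₚ.≤-reflexive (∣⊥∣≡0 n)) z≤n

    ∈-bad : ∀ {x y c} → ∣ agreement (bits n x) (bits n y) ∣ ℕ.< t →
      c ∈ agreement (bits n x) (bits n y) → c ∈ bad x y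
    ∈-bad {x} {y} x~y c∈ with x ~? y
    ... | yes _  = c∈
    ... | no x≁y = ⊥-elim (x≁y x~y)

    good : ∃[ c ] (c ∉ ⋃[ T ] λ x → ⋃[ T ] (bad x))
    good = ∣p∣<n⇒∃∉ _ (ℕₚ.≤-<-trans
      (∣⋃∣≤ T _ λ x → ∣⋃∣≤ T (bad x) (∣bad∣≤t x)) small)

    c = proj₁ good

    Q : Subset (2^ n)
    Q = tabulate λ x → lookup (bits n x) c

    monochromatic : ∀ {x y} → x ∈ T → y ∈ T → lookup Q x ≡ lookup Q y →
      ¬ (x ~ y)
    monochromatic {x} {y} x∈T y∈T eq x~y = proj₂ good
      (∈-⋃ _ x∈T (∈-⋃ (bad x) y∈T (∈-bad x~y (∈-agreement (bits n x) (bits n y)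
        (trans (sym (lookup∘tabulate _ x)) (trans eq (lookup∘tabulate _ y)))))))

    half : ∀ {a b} → a ℕ.≤ b → ∣ T ∣ ℕ.≤ b ℕ.+ a → ∣ T ∣ ℕ.≤ 2 ℕ.* b
    half {a} {b} a≤b T≤ = ℕₚ.≤-trans T≤ (ℕₚ.+-monoʳ-≤ b (ℕₚ.≤-trans a≤b (ℕₚ.m≤m+n b 0)))

  cube-locally-bipartite : IndependentPart 2 (cube n t t≤n) T
  cube-locally-bipartite with ℕₚ.≤-total ∣ T ∩ ∁ Q ∣ ∣ T ∩ Q ∣
  ... | inj₁ le = part (p∩q⊆p T Q)
    (λ x y x∈ y∈ → monochromatic (p∩q⊆p T Q x∈) (p∩q⊆p T Q y∈)
      (trans ([]=⇒lookup (p∩q⊆q T Q x∈)) (sym ([]=⇒lookup (p∩q⊆q T Q y∈)))))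
    (half le (∣p∣≤∣p∩q∣+∣p∩∁q∣ T Q))
  ... | inj₂ le = part (p∩q⊆p T (∁ Q))
    (λ x y x∈ y∈ → monochromatic (p∩q⊆p T (∁ Q) x∈) (p∩q⊆p T (∁ Q) y∈)
      (Boolₚ.not-injective (trans (sym (lookup-map x _ Q)) (trans
        (trans ([]=⇒lookup (p∩q⊆q T (∁ Q) x∈)) (sym ([]=⇒lookup (p∩q⊆q T (∁ Q) y∈))))
        (lookup-map y _ Q)))))
    (half le (ℕₚ.≤-trans (∣p∣≤∣p∩q∣+∣p∩∁q∣ T Q) (ℕₚ.≤-reflexive (ℕₚ.+-comm ∣ T ∩ Q ∣ _))))

-- Critical vertex sets and the graphs they span

∣p∣≤1+∣p-x∣ : ∀ {n} (p : Subset n) x → ∣ p ∣ ℕ.≤ suc ∣ p - x ∣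
∣p∣≤1+∣p-x∣ p x = begin
  ∣ p ∣                       ≤⟨ p⊆q⇒∣p∣≤∣q∣ cover ⟩
  ∣ ⁅ x ⁆ ∪ (p - x) ∣         ≤⟨ ∣p∪q∣≤∣p∣+∣q∣ ⁅ x ⁆ (p - x) ⟩
  ∣ ⁅ x ⁆ ∣ ℕ.+ ∣ p - x ∣     ≡⟨ cong (ℕ._+ ∣ p - x ∣) (∣⁅x⁆∣≡1 x) ⟩
  suc ∣ p - x ∣               ∎
  where
  open ℕₚ.≤-Reasoning
  cover : p ⊑ ⁅ x ⁆ ∪ (p - x)
  cover {y} y∈p with y Finₚ.≟ x
  ... | yes refl = x∈p∪q⁺ (inj₁ (x∈⁅x⁆ x))
  ... | no  y≢x  = x∈p∪q⁺ (inj₂ (x∈p∧x≢y⇒x∈p-y y∈p y≢x))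

∣p∣+∣q∩∁s∣≤∣p∪[q∩∁s]∣ : ∀ {n} (p q s : Subset n) → p ⊑ s → ∣ p ∣ ℕ.+ ∣ q ∩ ∁ s ∣ ℕ.≤ ∣ p ∪ (q ∩ ∁ s) ∣
∣p∣+∣q∩∁s∣≤∣p∪[q∩∁s]∣ []          []          []          _   = z≤n
∣p∣+∣q∩∁s∣≤∣p∪[q∩∁s]∣ (true  ∷ p) (_ ∷ q)     (false ∷ s) p⊑s with () ← p⊑s here
∣p∣+∣q∩∁s∣≤∣p∪[q∩∁s]∣ (true  ∷ p) (false ∷ q) (true  ∷ s) p⊑s = s≤s (∣p∣+∣q∩∁s∣≤∣p∪[q∩∁s]∣ p q s (drop-∷-⊆ p⊑s))
∣p∣+∣q∩∁s∣≤∣p∪[q∩∁s]∣ (true  ∷ p) (true  ∷ q) (true  ∷ s) p⊑s = s≤s (∣p∣+∣q∩∁s∣≤∣p∪[q∩∁s]∣ p q s (drop-∷-⊆ p⊑s))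
∣p∣+∣q∩∁s∣≤∣p∪[q∩∁s]∣ (false ∷ p) (false ∷ q) (_ ∷ s)     p⊑s = ∣p∣+∣q∩∁s∣≤∣p∪[q∩∁s]∣ p q s (drop-∷-⊆ p⊑s)
∣p∣+∣q∩∁s∣≤∣p∪[q∩∁s]∣ (false ∷ p) (true  ∷ q) (true  ∷ s) p⊑s = ∣p∣+∣q∩∁s∣≤∣p∪[q∩∁s]∣ p q s (drop-∷-⊆ p⊑s)
∣p∣+∣q∩∁s∣≤∣p∪[q∩∁s]∣ (false ∷ p) (true  ∷ q) (false ∷ s) p⊑s = ℕₚ.≤-trans
  (ℕₚ.≤-reflexive (ℕₚ.+-suc ∣ p ∣ _)) (s≤s (∣p∣+∣q∩∁s∣≤∣p∪[q∩∁s]∣ p q s (drop-∷-⊆ p⊑s)))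

module _ (G : Graph) (m : ℕ) where
  -- The strict inequality serves twice. Its failure for `S` says m ∣I∣ ≤ ∣S∣, which makes the
  -- weights m / ∣S∣ a packing; its truth for smaller sets leaves one unit to spare in
  -- `critical-part`.
  Sparse : Subset (v G) → Set
  Sparse T = ∃[ I ] (I ⊑ T × Independent G I × ∣ T ∣ ℕ.< m ℕ.* ∣ I ∣)

  sparse? : ∀ T → Dec (Sparse T)
  sparse? T = anySubset? λ I → (I ⊆? T) ×-dec (independent? G I ×-dec (∣ T ∣ ℕₚ.<? m ℕ.* ∣ I ∣))

  record Critical (S : Subset (v G)) : Set where
    field
      nonempty : Nonempty S
      dense    : ¬ Sparse S
      minimal  : ∀ T → Nonempty T → ∣ T ∣ ℕ.< ∣ S ∣ → Sparse T

  ∃-critical : ∀ S → Nonempty S → ¬ Sparse S → ∃[ S′ ] Critical S′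
  ∃-critical S = go S (<-wellFounded ∣ S ∣)
    where
    go : ∀ S → Acc ℕ._<_ ∣ S ∣ → Nonempty S → ¬ Sparse S → ∃[ S′ ] Critical S′
    go S (acc smaller) ne dense
      with anySubset? (λ T → nonempty? T ×-dec ((∣ T ∣ ℕₚ.<? ∣ S ∣) ×-dec ¬? (sparse? T)))
    ... | yes (T , neT , T<S , denseT) = go T (smaller T<S) neT denseT
    ... | no none = S , record { nonempty = ne ; dense = dense ; minimal = minimal }
      where
      minimal : ∀ T → Nonempty T → ∣ T ∣ ℕ.< ∣ S ∣ → Sparse T
      minimal T neT T<S with sparse? T
      ... | yes sparse = sparse
      ... | no  denseT = ⊥-elim (none (T , neT , T<S , denseT))

  -- Minimality speaks only of sets smaller than `S`, and `T` may be `S` itself. Deleting one vertex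
  -- makes it applicable, and the strict inequality in `Sparse` absorbs that vertex. A one-point `T`
  -- is its own part because `m` is positive.
  critical-part : .{{_ : ℕ.NonZero m}} → ∀ {S} → Critical S → ∀ T → T ⊑ S → IndependentPart m G T
  critical-part critical T T⊑S with nonempty? T
  ... | no empty = part {set = ⊥} ⊥⊆ (λ x y x∈⊥ → ⊥-elim (∉⊥ x∈⊥))
    (subst (λ T → ∣ T ∣ ℕ.≤ m ℕ.* ∣ ⊥ {v G} ∣) (sym (Empty-unique empty))
      (ℕₚ.≤-trans (ℕₚ.≤-reflexive (∣⊥∣≡0 (v G))) z≤n))
  ... | yes (x , x∈T) with nonempty? (T - x)
  ...   | no empty = part {set = ⁅ x ⁆} (λ y∈ → subst (_∈ T) (sym (x∈⁅y⁆⇒x≡y x y∈)) x∈T)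
    (singleton-independent G x)
    (begin
      ∣ T ∣              ≤⟨ ∣p∣≤1+∣p-x∣ T x ⟩
      suc ∣ T - x ∣      ≡⟨ cong (suc ∘ ∣_∣) (Empty-unique empty) ⟩
      suc ∣ ⊥ {v G} ∣    ≡⟨ cong suc (∣⊥∣≡0 (v G)) ⟩
      1                  ≤⟨ ℕ.>-nonZero⁻¹ m ⟩
      m                  ≡⟨ ℕₚ.*-identityʳ m ⟨
      m ℕ.* 1            ≡⟨ cong (m ℕ.*_) (∣⁅x⁆∣≡1 x) ⟨
      m ℕ.* ∣ ⁅ x ⁆ ∣    ∎)
    where open ℕₚ.≤-Reasoning
  ...   | yes ne with I , I⊑ , ind , T-x< ← Critical.minimal critical (T - x) ne
                        (ℕₚ.<-≤-trans (x∈p⇒∣p-x∣<∣p∣ x∈T) (p⊆q⇒∣p∣≤∣q∣ T⊑S)) =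
    part (⊆-trans I⊑ (p─q⊆p T ⁅ x ⁆)) ind (ℕₚ.≤-trans (∣p∣≤1+∣p-x∣ T x) T-x<)

-- The edges of G inside S; the vertices outside S stay, isolated, so that no
-- relabelling is needed.
restrict : (G : Graph) → Subset (v G) → Graph
restrict G S = record
  { v     = v G
  ; _~_   = λ x y → x ∈ S × y ∈ S × x ~ y
  ; ~-sym = λ (x∈S , y∈S , x~y) → y∈S , x∈S , ~-sym x~y
  ; ~-irr = λ x≡y (_ , _ , x~y) → ~-irr x≡y x~y
  ; _~?_  = λ x y → (x ∈? S) ×-dec ((y ∈? S) ×-dec (x ~? y))
  }
  where open Graph G using (_~_; ~-sym; ~-irr; _~?_)

restrict-local : ∀ {r} G S {T} → IndependentPart r G T → IndependentPart r (restrict G S) T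
restrict-local G S (part ⊑T ind large) = part ⊑T (λ x y x∈ y∈ (_ , _ , x~y) → ind x y x∈ y∈ x~y) large

-- The vertices of `T` outside `S` are isolated, so all of them can join the independent set found
-- in `T ∩ S`.
restrict-part : ∀ {m} .{{_ : ℕ.NonZero m}} G S → (∀ T → T ⊑ S → IndependentPart m G T) →
  ∀ T → IndependentPart m (restrict G S) T
restrict-part {m} G S parts T with part {set = I} I⊑ ind large ← parts (T ∩ S) (p∩q⊆q T S) = part
  (λ x∈ → [ (λ x∈I → p∩q⊆p T S (I⊑ x∈I)) , p∩q⊆p T (∁ S) ]′ (x∈p∪q⁻ I (T ∩ ∁ S) x∈))
  (λ x y x∈ y∈ (x∈S , y∈S , x~y) → ind x y (in-I x∈ x∈S) (in-I y∈ y∈S) x~y)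
  (begin
    ∣ T ∣                                        ≤⟨ ∣p∣≤∣p∩q∣+∣p∩∁q∣ T S ⟩
    ∣ T ∩ S ∣ ℕ.+ ∣ T ∩ ∁ S ∣                    ≤⟨ ℕₚ.+-mono-≤ large (ℕₚ.m≤n*m ∣ T ∩ ∁ S ∣ m) ⟩
    m ℕ.* ∣ I ∣ ℕ.+ m ℕ.* ∣ T ∩ ∁ S ∣            ≡⟨ ℕₚ.*-distribˡ-+ m ∣ I ∣ _ ⟨
    m ℕ.* (∣ I ∣ ℕ.+ ∣ T ∩ ∁ S ∣)                ≤⟨ ℕₚ.*-monoʳ-≤ m (∣p∣+∣q∩∁s∣≤∣p∪[q∩∁s]∣ I T S (p∩q⊆q T S ∘ I⊑)) ⟩
    m ℕ.* ∣ I ∪ (T ∩ ∁ S) ∣                      ∎)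
  where
  open ℕₚ.≤-Reasoning
  in-I : ∀ {x} → x ∈ I ∪ (T ∩ ∁ S) → x ∈ S → x ∈ I
  in-I x∈ x∈S with x∈p∪q⁻ I (T ∩ ∁ S) x∈
  ... | inj₁ x∈I = x∈I
  ... | inj₂ x∈′ = ⊥-elim (x∈∁p⇒x∉p (p∩q⊆q T (∁ S) x∈′) x∈S)

-- Fractions of natural numbers and rational sums

toℚᵘ-/ : ∀ a b → ℚ.toℚᵘ (ℤ.+ a ℚ./ suc b) ℚᵘ.≃ mkℚᵘ (ℤ.+ a) b
toℚᵘ-/ a b = ℚₚ.toℚᵘ-fromℚᵘ (mkℚᵘ (ℤ.+ a) b)

/-mono : ∀ a b c d .{{_ : ℕ.NonZero b}} .{{_ : ℕ.NonZero d}} →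
  a ℕ.* d ℕ.≤ c ℕ.* b → ℤ.+ a ℚ./ b ℚ.≤ ℤ.+ c ℚ./ d
/-mono a (suc b) c (suc d) ad≤cb = ℚₚ.toℚᵘ-cancel-≤ (begin
  ℚ.toℚᵘ (ℤ.+ a ℚ./ suc b)  ≃⟨ toℚᵘ-/ a b ⟩
  mkℚᵘ (ℤ.+ a) b            ≤⟨ ℚᵘ.*≤* (subst₂ ℤ._≤_ (ℤₚ.pos-* a (suc d)) (ℤₚ.pos-* c (suc b)) (ℤ.+≤+ ad≤cb)) ⟩
  mkℚᵘ (ℤ.+ c) d            ≃⟨ toℚᵘ-/ c d ⟨
  ℚ.toℚᵘ (ℤ.+ c ℚ./ suc d)  ∎)
  where open ℚᵘₚ.≤-Reasoning

ι : ℕ → ℚ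
ι n = ℤ.+ n ℚ./ 1

ι-mono : ∀ {m n} → m ℕ.≤ n → ι m ℚ.≤ ι n
ι-mono {m} {n} m≤n = /-mono m 1 n 1 (ℕₚ.*-monoˡ-≤ 1 m≤n)

0≤ι : ∀ n → 0ℚ ℚ.≤ ι n
0≤ι n = ι-mono {0} {n} z≤n

ι-+ : ∀ m n → ι (m ℕ.+ n) ≡ ι m ℚ.+ ι n
ι-+ m n = ℚₚ.toℚᵘ-injective (begin
  ℚ.toℚᵘ (ι (m ℕ.+ n))              ≈⟨ toℚᵘ-/ (m ℕ.+ n) 0 ⟩
  mkℚᵘ (ℤ.+ (m ℕ.+ n)) 0            ≈⟨ ℚᵘ.*≡* (shape (ℤ.+ m) (ℤ.+ n)) ⟩
  mkℚᵘ (ℤ.+ m) 0 ℚᵘ.+ mkℚᵘ (ℤ.+ n) 0 ≈⟨ ℚᵘₚ.+-cong (toℚᵘ-/ m 0) (toℚᵘ-/ n 0) ⟨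
  ℚ.toℚᵘ (ι m) ℚᵘ.+ ℚ.toℚᵘ (ι n)    ≈⟨ ℚₚ.toℚᵘ-homo-+ (ι m) (ι n) ⟨
  ℚ.toℚᵘ (ι m ℚ.+ ι n)              ∎)
  where
  open import Relation.Binary.Reasoning.Setoid ℚᵘₚ.≃-setoid
  shape : ∀ a b → (a ℤ.+ b) ℤ.* ℤ.+ 1 ≡ (a ℤ.* ℤ.+ 1 ℤ.+ b ℤ.* ℤ.+ 1) ℤ.* ℤ.+ 1
  shape = ℤ-solve-∀

ι*/ : ∀ p m n .{{_ : ℕ.NonZero n}} → ι p ℚ.* (ℤ.+ m ℚ./ n) ≡ ℤ.+ (p ℕ.* m) ℚ./ n
ι*/ p m (suc n) = ℚₚ.toℚᵘ-injective (begin
  ℚ.toℚᵘ (ι p ℚ.* (ℤ.+ m ℚ./ suc n))           ≈⟨ ℚₚ.toℚᵘ-homo-* (ι p) _ ⟩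
  ℚ.toℚᵘ (ι p) ℚᵘ.* ℚ.toℚᵘ (ℤ.+ m ℚ./ suc n)   ≈⟨ ℚᵘₚ.*-cong (toℚᵘ-/ p 0) (toℚᵘ-/ m n) ⟩
  mkℚᵘ (ℤ.+ p) 0 ℚᵘ.* mkℚᵘ (ℤ.+ m) n           ≈⟨ ℚᵘ.*≡* (cong₂ ℤ._*_ (sym (ℤₚ.pos-* p m))
                                                    (cong (ℤ.+_ ∘ suc) (sym (ℕₚ.+-identityʳ n)))) ⟩
  mkℚᵘ (ℤ.+ (p ℕ.* m)) n                       ≈⟨ toℚᵘ-/ (p ℕ.* m) n ⟨
  ℚ.toℚᵘ (ℤ.+ (p ℕ.* m) ℚ./ suc n)             ∎)
  where open import Relation.Binary.Reasoning.Setoid ℚᵘₚ.≃-setoid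

ι-* : ∀ m n → ι (m ℕ.* n) ≡ ι m ℚ.* ι n
ι-* m n = sym (ι*/ m n 1)

sum-mono : ∀ {n} {f g : Fin n → ℚ} → (∀ i → f i ℚ.≤ g i) → sum f ℚ.≤ sum g
sum-mono {zero}  f≤g = ℚₚ.≤-refl
sum-mono {suc n} f≤g = ℚₚ.+-mono-≤ (f≤g zero) (sum-mono (f≤g ∘ suc))

sum-++ : ∀ m {n} (f : Fin (m ℕ.+ n) → ℚ) → sum f ≡ sum (f ∘ (_↑ˡ n)) ℚ.+ sum (f ∘ (m ↑ʳ_))
sum-++ zero    f = sym (ℚₚ.+-identityˡ _)
sum-++ (suc m) {n} f = trans (cong (f zero ℚ.+_) (sum-++ m (f ∘ suc))) (sym (ℚₚ.+-assoc (f zero) (sum (f ∘ suc ∘ (_↑ˡ n))) _))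

-- Fractional cliques

weightOn : ∀ {n} → Subset n → (Fin n → ℚ) → ℚ
weightOn I y = sum λ u → if lookup I u then y u else 0ℚ

weightOn-const : ∀ {n} (I : Subset n) q → weightOn I (λ _ → q) ≡ ι ∣ I ∣ ℚ.* q
weightOn-const []          q = sym (ℚₚ.*-zeroˡ q)
weightOn-const (false ∷ I) q = trans (ℚₚ.+-identityˡ _) (weightOn-const I q)
weightOn-const (true  ∷ I) q = begin
  q ℚ.+ weightOn I (λ _ → q)         ≡⟨ cong₂ ℚ._+_ (sym (ℚₚ.*-identityˡ q)) (weightOn-const I q) ⟩
  1ℚ ℚ.* q ℚ.+ ι ∣ I ∣ ℚ.* q         ≡⟨ ℚₚ.*-distribʳ-+ q 1ℚ (ι ∣ I ∣) ⟨
  (1ℚ ℚ.+ ι ∣ I ∣) ℚ.* q             ≡⟨ cong (ℚ._* q) (ι-+ 1 ∣ I ∣) ⟨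
  ι (suc ∣ I ∣) ℚ.* q                ∎
  where open ≡-Reasoning

-- A feasible point of the dual program with value at least `k`; by weak duality it certifies χ_f ≥
-- k.
record FractionalClique (k : ℕ) (G : Graph) : Set where
  field
    weights : Fin (v G) → ℚ
    nonNeg  : ∀ u → 0ℚ ℚ.≤ weights u
    packing : ∀ I → Independent G I → weightOn I weights ℚ.≤ 1ℚ
    total   : ι k ℚ.≤ sum weights

critical-clique : ∀ {G m} S → Critical G m S → FractionalClique m (restrict G S)
critical-clique {G} {m} S critical = record
  { weights = y
  ; nonNeg  = λ u → if-nonNeg (lookup S u)
  ; packing = λ I ind → begin
      weightOn I y                        ≡⟨ sum-cong-≗ (nested I) ⟩
      weightOn (I ∩ S) (λ _ → q)          ≡⟨ weightOn-const (I ∩ S) q ⟩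
      ι ∣ I ∩ S ∣ ℚ.* q                   ≡⟨ ι*/ ∣ I ∩ S ∣ m (∣ S ∣) ⟩
      ℤ.+ (∣ I ∩ S ∣ ℕ.* m) ℚ./ ∣ S ∣     ≤⟨ /-mono (∣ I ∩ S ∣ ℕ.* m) (∣ S ∣) 1 1 (scaled (I ∩ S) (I∩S-small I ind)) ⟩
      1ℚ                                  ∎
  ; total   = begin
      ι m                                 ≤⟨ /-mono m 1 (∣ S ∣ ℕ.* m) (∣ S ∣) (ℕₚ.≤-reflexive (trans (ℕₚ.*-comm m ∣ S ∣) (sym (ℕₚ.*-identityʳ _)))) ⟩
      ℤ.+ (∣ S ∣ ℕ.* m) ℚ./ ∣ S ∣         ≡⟨ ι*/ ∣ S ∣ m (∣ S ∣) ⟨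
      ι ∣ S ∣ ℚ.* q                       ≡⟨ weightOn-const S q ⟨
      sum y                               ∎
  }
  where
  open ℚₚ.≤-Reasoning
  open Critical critical
  instance
    ∣S∣≢0 : ℕ.NonZero ∣ S ∣
    ∣S∣≢0 = ℕ.>-nonZero (ℕₚ.≤-<-trans z≤n (x∈p⇒∣p-x∣<∣p∣ (proj₂ nonempty)))
  q = ℤ.+ m ℚ./ ∣ S ∣
  y : Fin (v G) → ℚ
  y u = if lookup S u then q else 0ℚ

  if-nonNeg : ∀ b → 0ℚ ℚ.≤ (if b then q else 0ℚ)
  if-nonNeg true  = /-mono 0 1 m (∣ S ∣) z≤n
  if-nonNeg false = ℚₚ.≤-refl

  nested : ∀ I u → (if lookup I u then y u else 0ℚ) ≡ (if lookup (I ∩ S) u then q else 0ℚ)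
  nested I u rewrite lookup-zipWith _∧_ u I S with lookup I u
  ... | true  = refl
  ... | false = refl

  I∩S-small : ∀ I → Independent (restrict G S) I → m ℕ.* ∣ I ∩ S ∣ ℕ.≤ ∣ S ∣
  I∩S-small I ind = ℕₚ.≮⇒≥ λ lt → dense (I ∩ S , p∩q⊆q I S , (λ x y x∈ y∈ x~y →
    ind x y (p∩q⊆p I S x∈) (p∩q⊆p I S y∈) (p∩q⊆q I S x∈ , p∩q⊆q I S y∈ , x~y)) , lt)

  scaled : ∀ J → m ℕ.* ∣ J ∣ ℕ.≤ ∣ S ∣ → ∣ J ∣ ℕ.* m ℕ.* 1 ℕ.≤ 1 ℕ.* ∣ S ∣
  scaled J = subst₂ ℕ._≤_ (trans (ℕₚ.*-comm m ∣ J ∣) (sym (ℕₚ.*-identityʳ _))) (sym (ℕₚ.*-identityˡ _))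

∃-locally-bipartite : ∀ m M .{{_ : ℕ.NonZero m}} → ∃[ G ]
  ((∀ T → IndependentPart m G T) ×
   (∀ T → ∣ T ∣ ℕ.≤ M → IndependentPart 2 G T) ×
   FractionalClique m G)
∃-locally-bipartite m M = fromCritical (∃-critical G m ⊤ (nonempty n) dense)
  where
  c = suc (2 ℕ.* m)
  -- With this `s`, M² t = s · M² c < s (s + 1) = n: the edges among at most `M` vertices cannot
  -- have agreements in every coordinate. Also c ≤ s, whence t ≤ n.
  s = suc (M ℕ.* M) ℕ.* c
  n = s ℕ.* suc s
  t = s ℕ.* c

  instance
    s≢0 : ℕ.NonZero s
    s≢0 = ℕₚ.m*n≢0 (suc (M ℕ.* M)) c

  t≤n : t ℕ.≤ n
  t≤n = ℕₚ.*-monoʳ-≤ s (ℕₚ.m≤n⇒m≤1+n (ℕₚ.m≤n*m c (suc (M ℕ.* M))))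

  G = cube n t t≤n

  nonempty : ∀ n → Nonempty (⊤ {2^ n})
  nonempty zero    = zero , here
  nonempty (suc n) = proj₁ (nonempty n) ↑ˡ 2^ n , ∈⊤

  dense : ¬ Sparse G m ⊤
  dense (I , _ , ind , big) = ℕₚ.<⇒≱ big (subst (m ℕ.* ∣ I ∣ ℕ.≤_) (sym (∣⊤∣≡n (2^ n)))
    (small-if-agreeing s m I λ x∈I y∈I → ℕₚ.≮⇒≥ (ind _ _ x∈I y∈I)))

  few-pairs : ∀ (T : Subset (2^ n)) → ∣ T ∣ ℕ.≤ M → ∣ T ∣ ℕ.* (∣ T ∣ ℕ.* t) ℕ.< n
  few-pairs T T≤M = begin-strict
    ∣ T ∣ ℕ.* (∣ T ∣ ℕ.* t)       ≤⟨ ℕₚ.*-mono-≤ T≤M (ℕₚ.*-monoˡ-≤ t T≤M) ⟩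
    M ℕ.* (M ℕ.* (s ℕ.* c))      ≡⟨ shape M s c ⟩
    s ℕ.* (M ℕ.* M ℕ.* c)        <⟨ ℕₚ.*-monoʳ-< s (s≤s (ℕₚ.*-monoˡ-≤ c (ℕₚ.n≤1+n (M ℕ.* M)))) ⟩
    s ℕ.* suc s                  ∎
    where
    open ℕₚ.≤-Reasoning
    shape : ∀ M s c → M ℕ.* (M ℕ.* (s ℕ.* c)) ≡ s ℕ.* (M ℕ.* M ℕ.* c)
    shape = solve-∀

  fromCritical : ∃[ S ] Critical G m S → _
  fromCritical (S , critical) = restrict G S ,
    restrict-part G S (critical-part G m critical) ,
    (λ T T≤M → restrict-local G S (cube-locally-bipartite n t t≤n T (few-pairs T T≤M))) ,
    critical-clique S critical

-- Joins of graphs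

module _ (G H : Graph) where
  private
    module G = Graph G
    module H = Graph H
    a = v G
    b = v H

    Joined : Fin a ⊎ Fin b → Fin a ⊎ Fin b → Set
    Joined (inj₁ x) (inj₁ y) = x G.~ y
    Joined (inj₁ _) (inj₂ _) = Unit
    Joined (inj₂ _) (inj₁ _) = Unit
    Joined (inj₂ x) (inj₂ y) = x H.~ y

    joined-sym : ∀ i j → Joined i j → Joined j i
    joined-sym (inj₁ _) (inj₁ _) = G.~-sym
    joined-sym (inj₁ _) (inj₂ _) = _
    joined-sym (inj₂ _) (inj₁ _) = _
    joined-sym (inj₂ _) (inj₂ _) = H.~-sym

    joined-irr : ∀ i → ¬ Joined i i
    joined-irr (inj₁ _) = G.~-irr refl
    joined-irr (inj₂ _) = H.~-irr refl

    joined? : ∀ i j → Dec (Joined i j)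
    joined? (inj₁ x) (inj₁ y) = x G.~? y
    joined? (inj₁ _) (inj₂ _) = yes tt
    joined? (inj₂ _) (inj₁ _) = yes tt
    joined? (inj₂ x) (inj₂ y) = x H.~? y

  join : Graph
  join = record
    { v     = a ℕ.+ b
    ; _~_   = λ x y → Joined (splitAt a x) (splitAt a y)
    ; ~-sym = λ {x} {y} → joined-sym (splitAt a x) (splitAt a y)
    ; ~-irr = λ { {x} refl → joined-irr (splitAt a x) }
    ; _~?_  = λ x y → joined? (splitAt a x) (splitAt a y)
    }

  open Graph join using (_~_)

  private
    ˡˡ : ∀ x y → ((x ↑ˡ b) ~ (y ↑ˡ b)) ≡ (x G.~ y)
    ˡˡ x y = cong₂ Joined (splitAt-↑ˡ a x b) (splitAt-↑ˡ a y b)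

    ʳʳ : ∀ x y → ((a ↑ʳ x) ~ (a ↑ʳ y)) ≡ (x H.~ y)
    ʳʳ x y = cong₂ Joined (splitAt-↑ʳ a b x) (splitAt-↑ʳ a b y)

    ˡʳ : ∀ x y → (x ↑ˡ b) ~ (a ↑ʳ y)
    ˡʳ x y = subst id (sym (cong₂ Joined (splitAt-↑ˡ a x b) (splitAt-↑ʳ a b y))) tt

  independent-++⊥ : ∀ {I} → Independent G I → Independent join (I ++ ⊥)
  independent-++⊥ {I} ind x y x∈ y∈ with ∈-++⁻ I x∈ | ∈-++⁻ I y∈
  ... | left {i} i∈ | left {j} j∈ = ind i j i∈ j∈ ∘ subst id (ˡˡ i j)
  ... | right i∈    | _           = ⊥-elim (∉⊥ i∈)
  ... | left _      | right j∈    = ⊥-elim (∉⊥ j∈)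

  independent-⊥++ : ∀ {I} → Independent H I → Independent join (⊥ {a} ++ I)
  independent-⊥++ {I} ind x y x∈ y∈ with ∈-++⁻ (⊥ {a}) x∈ | ∈-++⁻ (⊥ {a}) y∈
  ... | right {i} i∈ | right {j} j∈ = ind i j i∈ j∈ ∘ subst id (ʳʳ i j)
  ... | left i∈      | _            = ⊥-elim (∉⊥ i∈)
  ... | right _      | left j∈      = ⊥-elim (∉⊥ j∈)

  independent-++⁻ : ∀ A B → Independent join (A ++ B) →
    Independent G A × Independent H B × (Empty A ⊎ Empty B)
  independent-++⁻ A B ind =
    (λ x y x∈ y∈ x~y → ind (x ↑ˡ b) (y ↑ˡ b) (∈-++⁺ˡ x∈) (∈-++⁺ˡ y∈) (subst id (sym (ˡˡ x y)) x~y)) ,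
    (λ x y x∈ y∈ x~y → ind (a ↑ʳ x) (a ↑ʳ y) (∈-++⁺ʳ A x∈) (∈-++⁺ʳ A y∈) (subst id (sym (ʳʳ x y)) x~y)) ,
    one-empty
    where
    one-empty : Empty A ⊎ Empty B
    one-empty with nonempty? A
    ... | no  empty     = inj₁ empty
    ... | yes (x , x∈A) = inj₂ λ (y , y∈B) → ind (x ↑ˡ b) (a ↑ʳ y) (∈-++⁺ˡ x∈A) (∈-++⁺ʳ A y∈B) (ˡʳ x y)

  part-++ˡ : ∀ {r} {A : Subset a} {B : Subset b} {I} → I ⊑ A → Independent G I →
    ∣ A ∣ ℕ.+ ∣ B ∣ ℕ.≤ r ℕ.* ∣ I ∣ → IndependentPart r join (A ++ B)
  part-++ˡ {r} {A} {B} {I} I⊑A ind large = part within (independent-++⊥ ind) (begin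
    ∣ A ++ B ∣            ≡⟨ ∣++∣ A B ⟩
    ∣ A ∣ ℕ.+ ∣ B ∣       ≤⟨ large ⟩
    r ℕ.* ∣ I ∣           ≡⟨ cong (r ℕ.*_) (ℕₚ.+-identityʳ ∣ I ∣) ⟨
    r ℕ.* (∣ I ∣ ℕ.+ 0)   ≡⟨ cong (λ z → r ℕ.* (∣ I ∣ ℕ.+ z)) (∣⊥∣≡0 b) ⟨
    r ℕ.* (∣ I ∣ ℕ.+ ∣ ⊥ {b} ∣) ≡⟨ cong (r ℕ.*_) (∣++∣ I ⊥) ⟨
    r ℕ.* ∣ I ++ ⊥ {b} ∣  ∎)
    where
    open ℕₚ.≤-Reasoning
    within : I ++ ⊥ ⊑ A ++ B
    within x∈ with ∈-++⁻ I x∈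
    ... | left  i∈ = ∈-++⁺ˡ (I⊑A i∈)
    ... | right i∈ = ⊥-elim (∉⊥ i∈)

  part-++ʳ : ∀ {r} {A : Subset a} {B : Subset b} {I} → I ⊑ B → Independent H I →
    ∣ A ∣ ℕ.+ ∣ B ∣ ℕ.≤ r ℕ.* ∣ I ∣ → IndependentPart r join (A ++ B)
  part-++ʳ {r} {A} {B} {I} I⊑B ind large = part within (independent-⊥++ ind) (begin
    ∣ A ++ B ∣            ≡⟨ ∣++∣ A B ⟩
    ∣ A ∣ ℕ.+ ∣ B ∣       ≤⟨ large ⟩
    r ℕ.* ∣ I ∣           ≡⟨ cong (λ z → r ℕ.* (z ℕ.+ ∣ I ∣)) (∣⊥∣≡0 a) ⟨
    r ℕ.* (∣ ⊥ {a} ∣ ℕ.+ ∣ I ∣) ≡⟨ cong (r ℕ.*_) (∣++∣ (⊥ {a}) I) ⟨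
    r ℕ.* ∣ ⊥ {a} ++ I ∣  ∎)
    where
    open ℕₚ.≤-Reasoning
    within : ⊥ {a} ++ I ⊑ A ++ B
    within x∈ with ∈-++⁻ (⊥ {a}) x∈
    ... | left  i∈ = ⊥-elim (∉⊥ i∈)
    ... | right i∈ = ∈-++⁺ʳ A (I⊑B i∈)

  -- If A contains an independent set larger than H, then B is negligible;
  -- otherwise A is small enough to be bipartite.
  join-part : ∀ {m r} → m ℕ.≤ suc r → (∀ T → IndependentPart m G T) →
    (∀ T → ∣ T ∣ ℕ.≤ m ℕ.* v H → IndependentPart 2 G T) →
    (∀ T → IndependentPart r H T) → ∀ T → IndependentPart (2 ℕ.+ r) join T
  join-part {m} {r} m≤1+r partsG localG partsH T
    with A , B , refl ← Vec.splitAt a T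
    with part {set = I} I⊑ indI I-large ← partsG A | part {set = K} K⊑ indK K-large ← partsH B
    with ℕₚ.≤-total (v H) ∣ I ∣
  ... | inj₁ v≤I = part-++ˡ I⊑ indI (begin
    ∣ A ∣ ℕ.+ ∣ B ∣             ≤⟨ ℕₚ.+-mono-≤ I-large (ℕₚ.≤-trans (∣p∣≤n B) v≤I) ⟩
    m ℕ.* ∣ I ∣ ℕ.+ ∣ I ∣       ≡⟨ ℕₚ.+-comm (m ℕ.* ∣ I ∣) ∣ I ∣ ⟩
    suc m ℕ.* ∣ I ∣             ≤⟨ ℕₚ.*-monoˡ-≤ ∣ I ∣ (s≤s m≤1+r) ⟩
    (2 ℕ.+ r) ℕ.* ∣ I ∣         ∎)
    where open ℕₚ.≤-Reasoning
  ... | inj₂ I≤v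
    with part {set = L} L⊑ indL L-large ← localG A (ℕₚ.≤-trans I-large (ℕₚ.*-monoʳ-≤ m I≤v))
    -- Now ∣A∣ ≤ 2 ∣L∣ and ∣B∣ ≤ r ∣K∣, so the larger of `L` and `K` alone serves all of `T` with
    -- ratio 2 + r.
    with ℕₚ.≤-total ∣ L ∣ ∣ K ∣
  ...   | inj₁ L≤K = part-++ʳ K⊑ indK (begin
    ∣ A ∣ ℕ.+ ∣ B ∣             ≤⟨ ℕₚ.+-mono-≤ (ℕₚ.≤-trans L-large (ℕₚ.*-monoʳ-≤ 2 L≤K)) K-large ⟩
    2 ℕ.* ∣ K ∣ ℕ.+ r ℕ.* ∣ K ∣ ≡⟨ ℕₚ.*-distribʳ-+ ∣ K ∣ 2 r ⟨
    (2 ℕ.+ r) ℕ.* ∣ K ∣         ∎)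
    where open ℕₚ.≤-Reasoning
  ...   | inj₂ K≤L = part-++ˡ L⊑ indL (begin
    ∣ A ∣ ℕ.+ ∣ B ∣             ≤⟨ ℕₚ.+-mono-≤ L-large (ℕₚ.≤-trans K-large (ℕₚ.*-monoʳ-≤ r K≤L)) ⟩
    2 ℕ.* ∣ L ∣ ℕ.+ r ℕ.* ∣ L ∣ ≡⟨ ℕₚ.*-distribʳ-+ ∣ L ∣ 2 r ⟨
    (2 ℕ.+ r) ℕ.* ∣ L ∣         ∎)
    where open ℕₚ.≤-Reasoning

  -- An independent set of a join lies on one side, so the two weightings never meet in a packing
  -- constraint and their totals add up.
  join-clique : ∀ {k l} → FractionalClique k G → FractionalClique l H → FractionalClique (k ℕ.+ l) join
  join-clique {k} {l} cG cH = record
    { weights = y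
    ; nonNeg  = λ u → [_,_] {C = λ i → 0ℚ ℚ.≤ [ cG.weights , cH.weights ]′ i} cG.nonNeg cH.nonNeg (splitAt a u)
    ; packing = packing
    ; total   = begin
        ι (k ℕ.+ l)                        ≡⟨ ι-+ k l ⟩
        ι k ℚ.+ ι l                        ≤⟨ ℚₚ.+-mono-≤ cG.total cH.total ⟩
        sum cG.weights ℚ.+ sum cH.weights  ≡⟨ cong₂ ℚ._+_ (sum-cong-≗ y-↑ˡ) (sum-cong-≗ y-↑ʳ) ⟨
        sum (y ∘ (_↑ˡ b)) ℚ.+ sum (y ∘ (a ↑ʳ_)) ≡⟨ sum-++ a y ⟨
        sum y                              ∎
    }
    where
    open ℚₚ.≤-Reasoning
    module cG = FractionalClique cG
    module cH = FractionalClique cH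
    y : Fin (a ℕ.+ b) → ℚ
    y u = [ cG.weights , cH.weights ]′ (splitAt a u)
    y-↑ˡ : ∀ x → y (x ↑ˡ b) ≡ cG.weights x
    y-↑ˡ x = cong [ cG.weights , cH.weights ]′ (splitAt-↑ˡ a x b)
    y-↑ʳ : ∀ x → y (a ↑ʳ x) ≡ cH.weights x
    y-↑ʳ x = cong [ cG.weights , cH.weights ]′ (splitAt-↑ʳ a b x)

    split-weight : ∀ A B → weightOn (A ++ B) y ≡ weightOn A cG.weights ℚ.+ weightOn B cH.weights
    split-weight A B = trans (sum-++ a _) (cong₂ ℚ._+_
      (sum-cong-≗ λ x → cong₂ (λ b q → if b then q else 0ℚ) (lookup-++ˡ A B x) (y-↑ˡ x))
      (sum-cong-≗ λ x → cong₂ (λ b q → if b then q else 0ℚ) (lookup-++ʳ A B x) (y-↑ʳ x)))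

    weightOn-empty : ∀ {n} {I : Subset n} w → Empty I → weightOn I w ≡ 0ℚ
    weightOn-empty {n} w empty rewrite Empty-unique empty = weightOn-⊥ n w
      where
      weightOn-⊥ : ∀ n w → weightOn (⊥ {n}) w ≡ 0ℚ
      weightOn-⊥ zero    w = refl
      weightOn-⊥ (suc n) w = trans (ℚₚ.+-identityˡ _) (weightOn-⊥ n (w ∘ suc))

    packing : ∀ I → Independent join I → weightOn I y ℚ.≤ 1ℚ
    packing I ind with A , B , refl ← Vec.splitAt a I with independent-++⁻ A B ind
    ... | indA , indB , inj₁ emptyA = begin
      weightOn (A ++ B) y                                 ≡⟨ split-weight A B ⟩
      weightOn A cG.weights ℚ.+ weightOn B cH.weights     ≡⟨ cong (ℚ._+ weightOn B cH.weights) (weightOn-empty cG.weights emptyA) ⟩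
      0ℚ ℚ.+ weightOn B cH.weights                        ≡⟨ ℚₚ.+-identityˡ _ ⟩
      weightOn B cH.weights                               ≤⟨ cH.packing B indB ⟩
      1ℚ                                                  ∎
    ... | indA , indB , inj₂ emptyB = begin
      weightOn (A ++ B) y                                 ≡⟨ split-weight A B ⟩
      weightOn A cG.weights ℚ.+ weightOn B cH.weights     ≡⟨ cong (weightOn A cG.weights ℚ.+_) (weightOn-empty cH.weights emptyB) ⟩
      weightOn A cG.weights ℚ.+ 0ℚ                        ≡⟨ ℚₚ.+-identityʳ _ ⟩
      weightOn A cG.weights                               ≤⟨ cG.packing A indA ⟩
      1ℚ                                                  ∎

emptyGraph : Graph
emptyGraph = record { v = 0 ; _~_ = λ () ; ~-sym = λ { {()} } ; ~-irr = λ { {()} } ; _~?_ = λ () }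

-- Each new summand is built after the join `H` it is added to, since it must be bipartite on the
-- scale m · v(H). Starting the bound at m + 1 ensures the condition m ≤ 1 + r of `join-part` at
-- every stage.
∃-join-of : ∀ m .{{_ : ℕ.NonZero m}} k → ∃[ G ]
  ((∀ T → IndependentPart (k ℕ.* 2 ℕ.+ suc m) G T) × FractionalClique (k ℕ.* m) G)
∃-join-of m zero = emptyGraph ,
  (λ { [] → part {set = []} id (λ ()) z≤n }) ,
  record { weights = λ () ; nonNeg = λ () ; packing = λ { [] _ → /-mono 0 1 1 1 z≤n } ; total = ℚₚ.≤-refl }
∃-join-of m (suc k) = extend (∃-join-of m k)
  where
  Bounded : ℕ → Graph → Set
  Bounded k G = (∀ T → IndependentPart (k ℕ.* 2 ℕ.+ suc m) G T) × FractionalClique (k ℕ.* m) G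

  add : ∀ H → Bounded k H → ∃[ G ]
    ((∀ T → IndependentPart m G T) ×
     (∀ T → ∣ T ∣ ℕ.≤ m ℕ.* v H → IndependentPart 2 G T) ×
     FractionalClique m G) → ∃[ J ] Bounded (suc k) J
  add H (partsH , cliqueH) (G , partsG , localG , cliqueG) = join G H ,
    join-part G H (ℕₚ.≤-trans (ℕₚ.n≤1+n m) (ℕₚ.m≤n+m (suc m) (suc (k ℕ.* 2)))) partsG localG partsH ,
    join-clique G H cliqueG cliqueH

  extend : ∃[ H ] Bounded k H → ∃[ J ] Bounded (suc k) J
  extend (H , bounded) = add H bounded (∃-locally-bipartite m (m ℕ.* v H))

-- Linear programming

0≤* : ∀ {p q} → 0ℚ ℚ.≤ p → 0ℚ ℚ.≤ q → 0ℚ ℚ.≤ p ℚ.* q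
0≤* {p} {q} 0≤p 0≤q = subst (ℚ._≤ p ℚ.* q) (ℚₚ.*-zeroʳ p) (ℚₚ.*-monoˡ-≤-nonNeg p {{ℚ.nonNegative 0≤p}} 0≤q)

0≤+ : ∀ {p q} → 0ℚ ℚ.≤ p → 0ℚ ℚ.≤ q → 0ℚ ℚ.≤ p ℚ.+ q
0≤+ 0≤p 0≤q = ℚₚ.+-mono-≤ 0≤p 0≤q

*-cancel-0≤ : ∀ {p q} → 0ℚ ℚ.< p → 0ℚ ℚ.≤ p ℚ.* q → 0ℚ ℚ.≤ q
*-cancel-0≤ {p} {q} 0<p 0≤pq = ℚₚ.*-cancelˡ-≤-pos p {{ℚ.positive 0<p}} (subst (ℚ._≤ p ℚ.* q) (sym (ℚₚ.*-zeroʳ p)) 0≤pq)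

*-cancelˡ-≤ : ∀ {p q r} → 0ℚ ℚ.< p → p ℚ.* q ℚ.≤ p ℚ.* r → q ℚ.≤ r
*-cancelˡ-≤ {p} 0<p = ℚₚ.*-cancelˡ-≤-pos p {{ℚ.positive 0<p}}

-- χ_f has to be attained, so the program is solved exactly over ℚ, where comparisons are decidable.
-- All variables `x I` and `t` are nonnegative; `t` stands for the objective and is treated last, so
-- that its least value is the optimum.
module FourierMotzkin {X : Set} (_≟_ : DecidableEquality X) where

  -- The inequality  0 ≤ Σ coef I · x I + slope · t + offset
  record Constraint : Set where
    field
      coef   : X → ℚ
      slope  : ℚ
      offset : ℚ
  open Constraint

  combine : ℚ → Constraint → ℚ → Constraint → Constraint
  combine p c q d = record
    { coef   = λ I → p ℚ.* coef c I ℚ.+ q ℚ.* coef d I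
    ; slope  = p ℚ.* slope c ℚ.+ q ℚ.* slope d
    ; offset = p ℚ.* offset c ℚ.+ q ℚ.* offset d
    }

  -- A constraint reads 0 ≤ σ c · q + ρ c, where `q` is the variable to eliminate and `ρ` the value
  -- of the rest. With both abstract, one argument covers each `x I` and finally `t`.
  module OneVariable (σ : Constraint → ℚ) where

    nonPos : List Constraint → List Constraint
    nonPos = filter λ c → σ c ℚₚ.≤? 0ℚ

    pos : List Constraint → List Constraint
    pos = filter λ c → ¬? (σ c ℚₚ.≤? 0ℚ)

    resolve : Constraint → Constraint → Constraint
    resolve c d = combine (σ c) d (ℚ.- σ d) c

    -- Positive `σ` means a lower bound for `q`, and `resolve` cancels `q` between a lower bound and
    -- an upper one. The implicit lower bound q ≥ 0, resolved with `d`, yields 0 ≤ ρ d; this is why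
    -- `nonPos cs` is kept.
    eliminate : List Constraint → List Constraint
    eliminate cs = nonPos cs List.++ cartesianProductWith resolve (pos cs) (nonPos cs)

    module _ (ρ : Constraint → ℚ)
             (linear : ∀ p c q d → ρ (combine p c q d) ≡ p ℚ.* ρ c ℚ.+ q ℚ.* ρ d) where

      Solves : ℚ → List Constraint → Set
      Solves q cs = ∀ {c} → c ∈ᴸ cs → 0ℚ ℚ.≤ σ c ℚ.* q ℚ.+ ρ c

      σ*-resolve : ∀ c d q → σ c ℚ.* (σ d ℚ.* q ℚ.+ ρ d) ≡ σ d ℚ.* (σ c ℚ.* q ℚ.+ ρ c) ℚ.+ ρ (resolve c d)
      σ*-resolve c d q = trans (shape (σ c) (σ d) q (ρ c) (ρ d))
        (cong (σ d ℚ.* (σ c ℚ.* q ℚ.+ ρ c) ℚ.+_) (sym (linear (σ c) d (ℚ.- σ d) c)))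
        where
        open +-*-Solver
        shape : ∀ a b q x y → a ℚ.* (b ℚ.* q ℚ.+ y) ≡ b ℚ.* (a ℚ.* q ℚ.+ x) ℚ.+ (a ℚ.* y ℚ.+ (ℚ.- b) ℚ.* x)
        shape = solve 5 (λ a b q x y → a :* (b :* q :+ y) := b :* (a :* q :+ x) :+ (a :* y :+ (:- b) :* x)) refl

      eliminate-complete : ∀ {q} cs → 0ℚ ℚ.≤ q → Solves q cs → ∀ {c} → c ∈ᴸ eliminate cs → 0ℚ ℚ.≤ ρ c
      eliminate-complete {q} cs 0≤q solves e∈ with ∈ᴸ-++⁻ (nonPos cs) e∈
      ... | inj₁ d∈ = nonPos-case (∈-filter⁻ _ {xs = cs} d∈)
        where
        nonPos-case : ∀ {d} → d ∈ᴸ cs × σ d ℚ.≤ 0ℚ → 0ℚ ℚ.≤ ρ d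
        nonPos-case {d} (d∈cs , σ≤0) = begin
          0ℚ                    ≤⟨ solves d∈cs ⟩
          σ d ℚ.* q ℚ.+ ρ d     ≤⟨ ℚₚ.+-monoˡ-≤ (ρ d) (ℚₚ.*-monoʳ-≤-nonNeg q {{ℚ.nonNegative 0≤q}} σ≤0) ⟩
          0ℚ ℚ.* q ℚ.+ ρ d      ≡⟨ cong (ℚ._+ ρ d) (ℚₚ.*-zeroˡ q) ⟩
          0ℚ ℚ.+ ρ d            ≡⟨ ℚₚ.+-identityˡ (ρ d) ⟩
          ρ d                   ∎
          where open ℚₚ.≤-Reasoning
      ... | inj₂ e∈′ with c , d , c∈ , d∈ , refl ← ∈-cartesianProductWith⁻ resolve (pos cs) (nonPos cs) e∈′ =
        pair-case (∈-filter⁻ _ {xs = cs} c∈) (∈-filter⁻ _ {xs = cs} d∈)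
        where
        pair-case : c ∈ᴸ cs × ¬ σ c ℚ.≤ 0ℚ → d ∈ᴸ cs × σ d ℚ.≤ 0ℚ → 0ℚ ℚ.≤ ρ (resolve c d)
        pair-case (c∈cs , σ≰0) (d∈cs , σ≤0) = subst (0ℚ ℚ.≤_) (sym shape)
          (0≤+ (0≤* (ℚₚ.<⇒≤ (ℚₚ.≰⇒> σ≰0)) (solves d∈cs))
               (0≤* (ℚₚ.neg-antimono-≤ σ≤0) (solves c∈cs)))
          where
          open +-*-Solver
          solved : ∀ a b r x → a ≡ b ℚ.* x ℚ.+ r → r ≡ a ℚ.+ (ℚ.- b) ℚ.* x
          solved a b r x refl = solve 3 (λ b r x → r := (b :* x :+ r) :+ (:- b) :* x) refl b r x
          shape : ρ (resolve c d) ≡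
            σ c ℚ.* (σ d ℚ.* q ℚ.+ ρ d) ℚ.+ (ℚ.- σ d) ℚ.* (σ c ℚ.* q ℚ.+ ρ c)
          shape = solved _ (σ d) _ (σ c ℚ.* q ℚ.+ ρ c) (σ*-resolve c d q)

      Tight : ℚ → List Constraint → Set
      Tight q cs = (q ≡ 0ℚ) ⊎ (∃[ c ] (c ∈ᴸ cs × σ c ℚ.* q ℚ.+ ρ c ≡ 0ℚ))

      -- The witness is the largest of 0 and the lower bounds - ρ c / σ c. That one of them is
      -- attained is recorded because both the upper bounds and minimality are derived from it.
      tight-solution : ∀ cs → (∀ {c} → c ∈ᴸ cs → 0ℚ ℚ.< σ c) →
        ∃[ q ] (0ℚ ℚ.≤ q × Solves q cs × Tight q cs)
      tight-solution []       _   = 0ℚ , ℚₚ.≤-refl , (λ ()) , inj₁ refl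
      tight-solution (c ∷ cs) 0<σ with q , 0≤q , solves , tight ← tight-solution cs (0<σ ∘ there)
        with 0ℚ ℚₚ.≤? σ c ℚ.* q ℚ.+ ρ c
      ... | yes ok = q , 0≤q , (λ { (here refl) → ok ; (there d∈) → solves d∈ }) ,
                     [ inj₁ , (λ (d , d∈ , eq) → inj₂ (d , there d∈ , eq)) ]′ tight
      ... | no  fails = raise (∃-divide (σ c) (ℚ.- ρ c) (0<σ (here refl)) 0<-ρ)
        where
        σq<-ρ : σ c ℚ.* q ℚ.< ℚ.- ρ c
        σq<-ρ = subst₂ ℚ._<_ (shape (σ c ℚ.* q) (ρ c)) (ℚₚ.+-identityˡ _) (ℚₚ.+-monoˡ-< (ℚ.- ρ c) (ℚₚ.≰⇒> fails))
          where
          open +-*-Solver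
          shape : ∀ a b → (a ℚ.+ b) ℚ.+ (ℚ.- b) ≡ a
          shape = solve 2 (λ a b → (a :+ b) :+ (:- b) := a) refl
        0<-ρ : 0ℚ ℚ.< ℚ.- ρ c
        0<-ρ = ℚₚ.≤-<-trans (0≤* (ℚₚ.<⇒≤ (0<σ (here refl))) 0≤q) σq<-ρ
        raise : ∃[ δ ] (0ℚ ℚ.< δ × σ c ℚ.* δ ≡ ℚ.- ρ c) →
          ∃[ q ] (0ℚ ℚ.≤ q × Solves q (c ∷ cs) × Tight q (c ∷ cs))
        raise (δ , 0<δ , eq) = δ , ℚₚ.<⇒≤ 0<δ ,
          (λ { (here refl) → ℚₚ.≤-reflexive (sym σδ+ρ≡0)
             ; {d} (there d∈) → ℚₚ.≤-trans (solves d∈) (ℚₚ.+-monoˡ-≤ (ρ d)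
                 (ℚₚ.*-monoˡ-≤-nonNeg (σ d) {{ℚ.nonNegative (ℚₚ.<⇒≤ (0<σ (there d∈)))}} q≤δ)) }) ,
          inj₂ (c , here refl , σδ+ρ≡0)
          where
          σδ+ρ≡0 : σ c ℚ.* δ ℚ.+ ρ c ≡ 0ℚ
          σδ+ρ≡0 = trans (cong (ℚ._+ ρ c) eq) (ℚₚ.+-inverseˡ (ρ c))
          q≤δ : q ℚ.≤ δ
          q≤δ = *-cancelˡ-≤ (0<σ (here refl)) (subst (σ c ℚ.* q ℚ.≤_) (sym eq) (ℚₚ.<⇒≤ σq<-ρ))

      -- Take the least `q` above all lower bounds. Where `c` is tight at `q`, σ c times the value
      -- of an upper constraint `d` is exactly the resolvent, which is nonnegative by hypothesis.
      -- Leastness serves the objective `t`.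
      eliminate-sound : ∀ cs → (∀ {c} → c ∈ᴸ eliminate cs → 0ℚ ℚ.≤ ρ c) →
        ∃[ q ] (0ℚ ℚ.≤ q × Solves q cs × (∀ {q′} → 0ℚ ℚ.≤ q′ → Solves q′ cs → q ℚ.≤ q′))
      eliminate-sound cs 0≤ρ
        with q , 0≤q , solves , tight ← tight-solution (pos cs) (ℚₚ.≰⇒> ∘ proj₂ ∘ ∈-filter⁻ _ {xs = cs}) =
        q , 0≤q , solves-all , least tight
        where
        solves-nonPos : Tight q (pos cs) → ∀ {d} → d ∈ᴸ nonPos cs → 0ℚ ℚ.≤ σ d ℚ.* q ℚ.+ ρ d
        solves-nonPos (inj₁ refl) {d} d∈ = subst (0ℚ ℚ.≤_)
          (sym (trans (cong (ℚ._+ ρ d) (ℚₚ.*-zeroʳ (σ d))) (ℚₚ.+-identityˡ (ρ d)))) (0≤ρ (∈ᴸ-++⁺ˡ d∈))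
        solves-nonPos (inj₂ (c , c∈ , eq)) {d} d∈ =
          *-cancel-0≤ (ℚₚ.≰⇒> (proj₂ (∈-filter⁻ _ {xs = cs} c∈))) (subst (0ℚ ℚ.≤_)
            (sym (trans (σ*-resolve c d q) (trans
              (cong (λ z → σ d ℚ.* z ℚ.+ ρ (resolve c d)) eq)
              (trans (cong (ℚ._+ ρ (resolve c d)) (ℚₚ.*-zeroʳ (σ d))) (ℚₚ.+-identityˡ _)))))
            (0≤ρ (∈ᴸ-++⁺ʳ (nonPos cs) (∈-cartesianProductWith⁺ resolve c∈ d∈))))

        solves-all : Solves q cs
        solves-all {c} c∈ with σ c ℚₚ.≤? 0ℚ
        ... | yes σ≤0 = solves-nonPos tight (∈-filter⁺ _ c∈ σ≤0)
        ... | no  σ≰0 = solves (∈-filter⁺ _ c∈ σ≰0)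

        least : Tight q (pos cs) → ∀ {q′} → 0ℚ ℚ.≤ q′ → Solves q′ cs → q ℚ.≤ q′
        least (inj₁ refl) 0≤q′ _ = 0≤q′
        least (inj₂ (c , c∈ , eq)) {q′} _ solves′ with c∈cs , σ≰0 ← ∈-filter⁻ _ {xs = cs} c∈ =
          *-cancelˡ-≤ (ℚₚ.≰⇒> σ≰0) (cancel (ρ c) (subst (ℚ._≤ σ c ℚ.* q′ ℚ.+ ρ c) (sym eq) (solves′ c∈cs)))
          where
          cancel : ∀ {a b} r → a ℚ.+ r ℚ.≤ b ℚ.+ r → a ℚ.≤ b
          cancel {a} {b} r le = subst₂ ℚ._≤_ (shape a r) (shape b r) (ℚₚ.+-monoˡ-≤ (ℚ.- r) le)
            where
            open +-*-Solver
            shape : ∀ a r → (a ℚ.+ r) ℚ.+ (ℚ.- r) ≡ a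
            shape = solve 2 (λ a r → (a :+ r) :+ (:- r) := a) refl

  -- Only variables in the list count, so elimination just removes `I` from the list and leaves the
  -- coefficients at `I` in place.
  value : List X → Constraint → (X → ℚ) → ℚ → ℚ
  value []      c x t = slope c ℚ.* t ℚ.+ offset c
  value (I ∷ L) c x t = coef c I ℚ.* x I ℚ.+ value L c x t

  value-combine : ∀ L x t p c q d → value L (combine p c q d) x t ≡ p ℚ.* value L c x t ℚ.+ q ℚ.* value L d x t
  value-combine [] x t p c q d = shape p q t (slope c) (offset c) (slope d) (offset d)
    where
    open +-*-Solver
    shape : ∀ p q t a b e f → (p ℚ.* a ℚ.+ q ℚ.* e) ℚ.* t ℚ.+ (p ℚ.* b ℚ.+ q ℚ.* f) ≡
      p ℚ.* (a ℚ.* t ℚ.+ b) ℚ.+ q ℚ.* (e ℚ.* t ℚ.+ f)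
    shape = solve 7 (λ p q t a b e f → (p :* a :+ q :* e) :* t :+ (p :* b :+ q :* f) :=
      p :* (a :* t :+ b) :+ q :* (e :* t :+ f)) refl
  value-combine (I ∷ L) x t p c q d = trans (cong ((p ℚ.* coef c I ℚ.+ q ℚ.* coef d I) ℚ.* x I ℚ.+_) (value-combine L x t p c q d))
    (shape p q (x I) (coef c I) (value L c x t) (coef d I) (value L d x t))
    where
    open +-*-Solver
    shape : ∀ p q t a b e f → (p ℚ.* a ℚ.+ q ℚ.* e) ℚ.* t ℚ.+ (p ℚ.* b ℚ.+ q ℚ.* f) ≡
      p ℚ.* (a ℚ.* t ℚ.+ b) ℚ.+ q ℚ.* (e ℚ.* t ℚ.+ f)
    shape = solve 7 (λ p q t a b e f → (p :* a :+ q :* e) :* t :+ (p :* b :+ q :* f) :=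
      p :* (a :* t :+ b) :+ q :* (e :* t :+ f)) refl

  value-cong : ∀ L c {x y} t → (∀ {I} → I ∈ᴸ L → x I ≡ y I) → value L c x t ≡ value L c y t
  value-cong []      c t x≡y = refl
  value-cong (I ∷ L) c t x≡y = cong₂ (λ p q → coef c I ℚ.* p ℚ.+ q) (x≡y (here refl)) (value-cong L c t (x≡y ∘ there))

  record Feasible (L : List X) (cs : List Constraint) (x : X → ℚ) (t : ℚ) : Set where
    constructor feasible
    field
      x≥0   : ∀ {I} → I ∈ᴸ L → 0ℚ ℚ.≤ x I
      t≥0   : 0ℚ ℚ.≤ t
      holds : ∀ {c} → c ∈ᴸ cs → 0ℚ ℚ.≤ value L c x t

  update : X → ℚ → (X → ℚ) → X → ℚ
  update I q x J with I ≟ J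
  ... | yes _ = q
  ... | no  _ = x J

  update-same : ∀ I q x → update I q x I ≡ q
  update-same I q x with I ≟ I
  ... | yes _  = refl
  ... | no I≢I = ⊥-elim (I≢I refl)

  update-other : ∀ {I J} q x → I ≢ J → update I q x J ≡ x J
  update-other {I} {J} q x I≢J with I ≟ J
  ... | yes I≡J = ⊥-elim (I≢J I≡J)
  ... | no  _   = refl

  eliminate-head : ∀ {I L cs x t} → Feasible (I ∷ L) cs x t →
    Feasible L (OneVariable.eliminate (λ c → coef c I) cs) x t
  eliminate-head {I} {L} {cs} {x} {t} (feasible x≥0 t≥0 holds) = feasible (x≥0 ∘ there) t≥0
    (OneVariable.eliminate-complete (λ c → coef c I) (λ c → value L c x t)
      (value-combine L x t) cs (x≥0 (here refl)) holds)

  restore-head : ∀ {I L cs x t} → All (I ≢_) L →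
    Feasible L (OneVariable.eliminate (λ c → coef c I) cs) x t → ∃[ y ] Feasible (I ∷ L) cs y t
  restore-head {I} {L} {cs} {x} {t} I∉L (feasible x≥0 t≥0 holds)
    with q , 0≤q , solves , _ ← OneVariable.eliminate-sound (λ c → coef c I) (λ c → value L c x t)
                                  (value-combine L x t) cs holds =
    y , feasible
      (λ { (here refl) → subst (0ℚ ℚ.≤_) (sym (update-same I q x)) 0≤q
         ; (there J∈) → subst (0ℚ ℚ.≤_) (sym (y≡x J∈)) (x≥0 J∈) })
      t≥0
      (λ {c} c∈ → subst (0ℚ ℚ.≤_)
        (cong₂ (λ p r → coef c I ℚ.* p ℚ.+ r) (sym (update-same I q x)) (sym (value-cong L c t y≡x)))
        (solves c∈))
    where
    y : X → ℚ
    y = update I q x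
    y≡x : ∀ {J} → J ∈ᴸ L → y J ≡ x J
    y≡x J∈ = update-other q x (All.lookup I∉L J∈)

  -- Elimination does not alter `t`: every feasible point projects down with the same `t`, so the
  -- least `t` of the final one-variable system is least for the original, and its witness lifts
  -- back one variable at a time.
  minimum : ∀ {L cs x₀ t₀} → Unique L → Feasible L cs x₀ t₀ →
    ∃[ x ] ∃[ t ] (Feasible L cs x t × (∀ {x′ t′} → Feasible L cs x′ t′ → t ℚ.≤ t′))
  minimum {[]} {cs} {x₀} [] (feasible x≥0 t≥0 holds)
    with t , 0≤t , solves , least ← OneVariable.eliminate-sound slope offset (λ _ _ _ _ → refl) cs
           (OneVariable.eliminate-complete slope offset (λ _ _ _ _ → refl) cs t≥0 holds) =
    x₀ , t , feasible (λ ()) 0≤t solves , λ (feasible _ 0≤t′ holds′) → least 0≤t′ holds′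
  minimum {I ∷ L} (I∉L ∷ unique) feasible₀
    with x , t , feas , least ← minimum unique (eliminate-head feasible₀)
    with y , feas′ ← restore-head I∉L feas =
    y , t , feas′ , least ∘ eliminate-head

-- The linear program of fractional colourings

∑ℚ : {A : Set} → List A → (A → ℚ) → ℚ
∑ℚ xs f = foldr ℚ._+_ 0ℚ (map f xs)

seq-∑ : ∀ {A : Set} (xs : List A) f n → seq (∑ xs f) n ≡ ∑ℚ xs (λ a → seq (f a) n)
seq-∑ []       f n = refl
seq-∑ (x ∷ xs) f n = cong (seq (f x) n ℚ.+_) (seq-∑ xs f n)

0≤∑ℚ : ∀ {A : Set} (xs : List A) {f} → (∀ {a} → a ∈ᴸ xs → 0ℚ ℚ.≤ f a) → 0ℚ ℚ.≤ ∑ℚ xs f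
0≤∑ℚ []       0≤f = ℚₚ.≤-refl
0≤∑ℚ (x ∷ xs) 0≤f = 0≤+ (0≤f (here refl)) (0≤∑ℚ xs (0≤f ∘ there))

∈⇒≤∑ℚ : ∀ {A : Set} (xs : List A) {f a} → (∀ {a} → a ∈ᴸ xs → 0ℚ ℚ.≤ f a) → a ∈ᴸ xs → f a ℚ.≤ ∑ℚ xs f
∈⇒≤∑ℚ (x ∷ xs) {f} 0≤f (here refl) = subst (ℚ._≤ ∑ℚ (x ∷ xs) f) (ℚₚ.+-identityʳ (f x))
  (ℚₚ.+-monoʳ-≤ (f x) (0≤∑ℚ xs (0≤f ∘ there)))
∈⇒≤∑ℚ (x ∷ xs) {f} {a} 0≤f (there a∈) = subst (ℚ._≤ ∑ℚ (x ∷ xs) f) (ℚₚ.+-identityˡ (f a))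
  (ℚₚ.+-mono-≤ (0≤f (here refl)) (∈⇒≤∑ℚ xs (0≤f ∘ there) a∈))

∑ℚ-shift : ∀ {A : Set} (xs : List A) f δ → ∑ℚ xs (λ a → f a ℚ.+ δ) ≡ ∑ℚ xs f ℚ.+ ∑ℚ xs (λ _ → δ)
∑ℚ-shift []       f δ = refl
∑ℚ-shift (x ∷ xs) f δ = trans (cong (f x ℚ.+ δ ℚ.+_) (∑ℚ-shift xs f δ)) (shape (f x) δ _ _)
  where
  open +-*-Solver
  shape : ∀ a b c d → (a ℚ.+ b) ℚ.+ (c ℚ.+ d) ≡ (a ℚ.+ c) ℚ.+ (b ℚ.+ d)
  shape = solve 4 (λ a b c d → (a :+ b) :+ (c :+ d) := (a :+ c) :+ (b :+ d)) refl

-- Lifting a solution sets one variable at a time and must not disturb the others, so the variables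
-- have to be listed without repetition.
allSubsets-unique : ∀ n → Unique (allSubsets n)
allSubsets-unique zero    = All.[] ∷ []
allSubsets-unique (suc n) = Uniqueₚ.++⁺
  (Uniqueₚ.map⁺ ∷-injectiveʳ (allSubsets-unique n)) (Uniqueₚ.map⁺ ∷-injectiveʳ (allSubsets-unique n))
  λ (false∈ , true∈) → disjoint (∈-map⁻ _ false∈) (∈-map⁻ _ true∈)
  where
  disjoint : ∀ {S : Subset (suc n)} →
    ∃[ T ] (T ∈ᴸ allSubsets n × S ≡ false ∷ T) → ¬ (∃[ T ] (T ∈ᴸ allSubsets n × S ≡ true ∷ T))
  disjoint (_ , _ , refl) (_ , _ , ())

module _ (G : Graph) where
  private
    L = independentSets G

  ∈-independentSets : ∀ {I} → Independent G I → I ∈ᴸ L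
  ∈-independentSets {I} = ∈-filter⁺ (independent? G) (∈-allSubsets I)

  independentSets⁻ : ∀ {I} → I ∈ᴸ L → Independent G I
  independentSets⁻ = proj₂ ∘ ∈-filter⁻ (independent? G) {xs = allSubsets (v G)}

  containing : Fin (v G) → List (Subset (v G))
  containing u = filter (u ∈?_) L

  ⁅u⁆∈containing : ∀ u → ⁅ u ⁆ ∈ᴸ containing u
  ⁅u⁆∈containing u = ∈-filter⁺ (u ∈?_) (∈-independentSets (singleton-independent G u)) (x∈⁅x⁆ u)

  record RationalColouring (x : Subset (v G) → ℚ) : Set where
    field
      nonNeg : ∀ {I} → I ∈ᴸ L → 0ℚ ℚ.≤ x I
      covers : ∀ u → 1ℚ ℚ.≤ ∑ℚ (containing u) x

  private
    open FourierMotzkin {Subset (v G)} (≡-dec Boolₚ._≟_)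

    cover : Fin (v G) → Constraint
    cover u = record { coef = λ I → if does (u ∈? I) then 1ℚ else 0ℚ ; slope = 0ℚ ; offset = ℚ.- 1ℚ }

    -- The inequality Σ x I ≤ t turns the weight to be minimised into the single variable `t`.
    objective : Constraint
    objective = record { coef = λ _ → ℚ.- 1ℚ ; slope = 1ℚ ; offset = 0ℚ }

    value-cover : ∀ xs u x t → value xs (cover u) x t ≡ ∑ℚ (filter (u ∈?_) xs) x ℚ.- 1ℚ
    value-cover []       u x t = cong (ℚ._+ (ℚ.- 1ℚ)) (ℚₚ.*-zeroˡ t)
    value-cover (I ∷ xs) u x t with u ∈? I
    ... | yes _ = trans (cong₂ ℚ._+_ (ℚₚ.*-identityˡ (x I)) (value-cover xs u x t)) (sym (ℚₚ.+-assoc (x I) _ _))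
    ... | no  _ = trans (cong₂ ℚ._+_ (ℚₚ.*-zeroˡ (x I)) (value-cover xs u x t)) (ℚₚ.+-identityˡ _)

    value-objective : ∀ xs x t → value xs objective x t ≡ t ℚ.- ∑ℚ xs x
    value-objective []       x t = solve 1 (λ t → con 1ℚ :* t :+ con 0ℚ := t :- con 0ℚ) refl t
      where open +-*-Solver
    value-objective (I ∷ xs) x t = trans (cong (ℚ.- 1ℚ ℚ.* x I ℚ.+_) (value-objective xs x t))
      (solve 3 (λ t a b → con (ℚ.- 1ℚ) :* a :+ (t :- b) := t :- (a :+ b)) refl t (x I) (∑ℚ xs x))
      where open +-*-Solver

    constraints : List Constraint
    constraints = objective ∷ List.tabulate cover

    0≤-⇒≤ : ∀ {p q} → 0ℚ ℚ.≤ q ℚ.- p → p ℚ.≤ q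
    0≤-⇒≤ {p} {q} le = subst₂ ℚ._≤_ (ℚₚ.+-identityˡ p)
      (solve 2 (λ p q → q :- p :+ p := q) refl p q) (ℚₚ.+-monoˡ-≤ p le)
      where open +-*-Solver

    ≤⇒0≤- : ∀ {p q} → p ℚ.≤ q → 0ℚ ℚ.≤ q ℚ.- p
    ≤⇒0≤- {p} {q} le = subst (ℚ._≤ q ℚ.- p) (ℚₚ.+-inverseʳ p) (ℚₚ.+-monoˡ-≤ (ℚ.- p) le)

    toFeasible : ∀ {x} → RationalColouring x → Feasible L constraints x (∑ℚ L x)
    toFeasible {x} colouring = feasible nonNeg (0≤∑ℚ L nonNeg)
      λ { (here refl) → subst (0ℚ ℚ.≤_) (sym (value-objective L x _)) (≤⇒0≤- (ℚₚ.≤-refl {∑ℚ L x}))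
        ; (there c∈)  → covered (∈-tabulate⁻ c∈) }
      where
      open RationalColouring colouring
      covered : ∀ {c} → ∃[ u ] (c ≡ cover u) → 0ℚ ℚ.≤ value L c x (∑ℚ L x)
      covered (u , refl) = subst (0ℚ ℚ.≤_) (sym (value-cover L u x _)) (≤⇒0≤- (covers u))

    fromFeasible : ∀ {x t} → Feasible L constraints x t → RationalColouring x × ∑ℚ L x ℚ.≤ t
    fromFeasible {x} {t} (feasible x≥0 _ holds) = record
      { nonNeg = x≥0
      ; covers = λ u → 0≤-⇒≤ (subst (0ℚ ℚ.≤_) (value-cover L u x t) (holds (there (∈-tabulate⁺ u))))
      } , 0≤-⇒≤ (subst (0ℚ ℚ.≤_) (value-objective L x t) (holds (here refl)))

    one-colouring : RationalColouring (λ _ → 1ℚ)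
    one-colouring = record
      { nonNeg = λ _ → 0≤ι 1
      ; covers = λ u → ∈⇒≤∑ℚ (containing u) (λ _ → 0≤ι 1) (⁅u⁆∈containing u)
      }

  ∃-optimal-colouring : ∃[ x ] (RationalColouring x ×
    (∀ {x′} → RationalColouring x′ → ∑ℚ L x ℚ.≤ ∑ℚ L x′))
  ∃-optimal-colouring = optimal (minimum unique (toFeasible one-colouring))
    where
    unique : Unique L
    unique = Uniqueₚ.filter⁺ (independent? G) (allSubsets-unique (v G))

    optimal : ∃[ x ] ∃[ t ] (Feasible L constraints x t ×
        (∀ {x′ t′} → Feasible L constraints x′ t′ → t ℚ.≤ t′)) →
      ∃[ x ] (RationalColouring x × (∀ {x′} → RationalColouring x′ → ∑ℚ L x ℚ.≤ ∑ℚ L x′))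
    optimal (x , t , feas , least) = x , proj₁ (fromFeasible feas) ,
      λ colouring′ → ℚₚ.≤-trans (proj₂ (fromFeasible feas)) (least (toFeasible colouring′))

-- Weak duality, and optimality among real colourings

double-count : ∀ {n} (xs : List (Subset n)) x (y : Fin n → ℚ) →
  sum (λ u → y u ℚ.* ∑ℚ (filter (u ∈?_) xs) x) ≡ ∑ℚ xs (λ I → x I ℚ.* weightOn I y)
double-count {n} [] x y = trans (sum-cong-≗ λ u → trans (ℚₚ.*-zeroʳ (y u)) (sym (ℚₚ.*-zeroˡ (y u))))
  (trans (sym (*-distribˡ-sum 0ℚ y)) (ℚₚ.*-zeroˡ (sum y)))
double-count (I ∷ xs) x y = begin
  sum (λ u → y u ℚ.* ∑ℚ (filter (u ∈?_) (I ∷ xs)) x)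
    ≡⟨ sum-cong-≗ split ⟩
  sum (λ u → x I ℚ.* on u ℚ.+ y u ℚ.* ∑ℚ (filter (u ∈?_) xs) x)
    ≡⟨ ∑-distrib-+ (λ u → x I ℚ.* on u) _ ⟩
  sum (λ u → x I ℚ.* on u) ℚ.+ sum (λ u → y u ℚ.* ∑ℚ (filter (u ∈?_) xs) x)
    ≡⟨ cong₂ ℚ._+_ (sym (*-distribˡ-sum (x I) on)) (double-count xs x y) ⟩
  x I ℚ.* weightOn I y ℚ.+ ∑ℚ xs (λ I → x I ℚ.* weightOn I y) ∎
  where
  open ≡-Reasoning
  on : _ → ℚ
  on u = if lookup I u then y u else 0ℚ
  split : ∀ u → y u ℚ.* ∑ℚ (filter (u ∈?_) (I ∷ xs)) x ≡ x I ℚ.* on u ℚ.+ y u ℚ.* ∑ℚ (filter (u ∈?_) xs) x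
  split u with u ∈? I | lookup I u in eq
  ... | yes _   | true  = trans (ℚₚ.*-distribˡ-+ (y u) (x I) _) (cong (ℚ._+ y u ℚ.* ∑ℚ (filter (u ∈?_) xs) x) (ℚₚ.*-comm (y u) (x I)))
  ... | yes u∈I | false with () ← trans (sym eq) ([]=⇒lookup u∈I)
  ... | no  u∉I | true  = ⊥-elim (u∉I (lookup⇒[]= u I eq))
  ... | no  _   | false = trans (sym (ℚₚ.+-identityˡ _)) (cong (ℚ._+ y u ℚ.* ∑ℚ (filter (u ∈?_) xs) x) (sym (ℚₚ.*-zeroʳ (x I))))

∑ℚ-mono : ∀ {A : Set} (xs : List A) {f g} → (∀ {a} → a ∈ᴸ xs → f a ℚ.≤ g a) → ∑ℚ xs f ℚ.≤ ∑ℚ xs g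
∑ℚ-mono []       f≤g = ℚₚ.≤-refl
∑ℚ-mono (x ∷ xs) f≤g = ℚₚ.+-mono-≤ (f≤g (here refl)) (∑ℚ-mono xs (f≤g ∘ there))

∑ℚ-const : ∀ {A : Set} (xs : List A) q → ∑ℚ xs (λ _ → q) ≡ ι (length xs) ℚ.* q
∑ℚ-const []       q = sym (ℚₚ.*-zeroˡ q)
∑ℚ-const (x ∷ xs) q = begin
  q ℚ.+ ∑ℚ xs (λ _ → q)                  ≡⟨ cong₂ ℚ._+_ (sym (ℚₚ.*-identityˡ q)) (∑ℚ-const xs q) ⟩
  1ℚ ℚ.* q ℚ.+ ι (length xs) ℚ.* q       ≡⟨ ℚₚ.*-distribʳ-+ q 1ℚ (ι (length xs)) ⟨
  (1ℚ ℚ.+ ι (length xs)) ℚ.* q           ≡⟨ cong (ℚ._* q) (ι-+ 1 (length xs)) ⟨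
  ι (suc (length xs)) ℚ.* q              ∎
  where open ≡-Reasoning

Eventually : (ℕ → Set) → Set
Eventually P = ∃[ N ] ∀ n → N ℕ.≤ n → P n

eventually-all : ∀ {A : Set} (xs : List A) {P : A → ℕ → Set} →
  (∀ {a} → a ∈ᴸ xs → Eventually (P a)) → Eventually (λ n → ∀ {a} → a ∈ᴸ xs → P a n)
eventually-all []       _  = 0 , λ _ _ ()
eventually-all (x ∷ xs) ev with N , P-x ← ev (here refl) | M , P-xs ← eventually-all xs (ev ∘ there) =
  N ℕ.⊔ M , λ { n ≤n (here refl) → P-x n (ℕₚ.m⊔n≤o⇒m≤o N M ≤n) ; n ≤n (there a∈) → P-xs n (ℕₚ.m⊔n≤o⇒n≤o N M ≤n) a∈ }

fromℚ-mono : ∀ {p q} → p ℚ.≤ q → fromℚ p ≤ fromℚ q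
fromℚ-mono {p} {q} p≤q ε 0<ε = 0 , λ _ _ → ℚₚ.≤-trans p≤q
  (subst (ℚ._≤ q ℚ.+ ε) (ℚₚ.+-identityʳ q) (ℚₚ.+-monoʳ-≤ q (ℚₚ.<⇒≤ 0<ε)))

module _ (G : Graph) where
  private
    L = independentSets G

  weak-duality : ∀ {k x} → FractionalClique k G → RationalColouring G x → ι k ℚ.≤ ∑ℚ L x
  weak-duality {k} {x} clique colouring = begin
    ι k                                                    ≤⟨ total ⟩
    sum weights                                            ≤⟨ sum-mono covered ⟩
    sum (λ u → weights u ℚ.* ∑ℚ (containing G u) x)        ≡⟨ double-count L x weights ⟩
    ∑ℚ L (λ I → x I ℚ.* weightOn I weights)                ≤⟨ ∑ℚ-mono L packed ⟩
    ∑ℚ L x                                                 ∎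
    where
    open ℚₚ.≤-Reasoning
    open FractionalClique clique renaming (nonNeg to 0≤weights)
    open RationalColouring colouring
    covered : ∀ u → weights u ℚ.≤ weights u ℚ.* ∑ℚ (containing G u) x
    covered u = subst (ℚ._≤ weights u ℚ.* ∑ℚ (containing G u) x) (ℚₚ.*-identityʳ _)
      (ℚₚ.*-monoˡ-≤-nonNeg (weights u) {{ℚ.nonNegative (0≤weights u)}} (covers u))
    packed : ∀ {I} → I ∈ᴸ L → x I ℚ.* weightOn I weights ℚ.≤ x I
    packed {I} I∈ = subst (x I ℚ.* weightOn I weights ℚ.≤_) (ℚₚ.*-identityʳ _)
      (ℚₚ.*-monoˡ-≤-nonNeg (x I) {{ℚ.nonNegative (nonNeg I∈)}} (packing I (independentSets⁻ G I∈)))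

  -- Adding δ to every entry of a late enough rational approximation of a real
  -- colouring makes it an exact colouring.
  optimal-among-reals : ∀ {c} → (∀ {x} → RationalColouring G x → c ℚ.≤ ∑ℚ L x) →
    ∀ x → IsFractionalColouring G x → fromℚ c ≤ weight G x
  optimal-among-reals {c} least x (x≥0 , x-covers) ε 0<ε = approximate
    -- Raising every entry by δ raises the weight by ∣L∣ δ, so δ = ε / (∣L∣ + 1) is small enough.
    (∃-divide (ι (suc (length L))) ε (ℚₚ.<-≤-trans (ℚₚ.positive⁻¹ 1ℚ) (ι-mono {1} {suc (length L)} (s≤s z≤n))) 0<ε)
    where
    approximate : ∃[ δ ] (0ℚ ℚ.< δ × ι (suc (length L)) ℚ.* δ ≡ ε) →
      Eventually (λ n → c ℚ.≤ seq (weight G x) n ℚ.+ ε)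
    approximate (δ , 0<δ , eq) = N ℕ.⊔ M , λ n ≤n →
      bound n (late-nonNeg n (ℕₚ.m⊔n≤o⇒m≤o N M ≤n)) (late-covers n (ℕₚ.m⊔n≤o⇒n≤o N M ≤n))
      where
      nonNeg-eventually : Eventually (λ n → ∀ {I} → I ∈ᴸ L → 0ℚ ℚ.≤ seq (x I) n ℚ.+ δ)
      nonNeg-eventually = eventually-all L λ I∈ → x≥0 _ (independentSets⁻ G I∈) δ 0<δ
      covers-eventually : Eventually (λ n → ∀ {u} → u ∈ᴸ allFin (v G) → 1ℚ ℚ.≤ seq (∑ (containing G u) x) n ℚ.+ δ)
      covers-eventually = eventually-all (allFin (v G)) λ {u} _ → x-covers u δ 0<δ
      N = proj₁ nonNeg-eventually
      M = proj₁ covers-eventually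
      late-nonNeg = proj₂ nonNeg-eventually
      late-covers = proj₂ covers-eventually

      bound : ∀ n → (∀ {I} → I ∈ᴸ L → 0ℚ ℚ.≤ seq (x I) n ℚ.+ δ) →
        (∀ {u} → u ∈ᴸ allFin (v G) → 1ℚ ℚ.≤ seq (∑ (containing G u) x) n ℚ.+ δ) →
        c ℚ.≤ seq (weight G x) n ℚ.+ ε
      bound n nonNegₙ coversₙ = begin
        c                                          ≤⟨ least (record { nonNeg = nonNegₙ ; covers = covers }) ⟩
        ∑ℚ L (λ I → xₙ I ℚ.+ δ)                    ≡⟨ ∑ℚ-shift L xₙ δ ⟩
        ∑ℚ L xₙ ℚ.+ ∑ℚ L (λ _ → δ)                 ≡⟨ cong₂ ℚ._+_ (sym (seq-∑ L x n)) (∑ℚ-const L δ) ⟩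
        seq (weight G x) n ℚ.+ ι (length L) ℚ.* δ  ≤⟨ ℚₚ.+-monoʳ-≤ (seq (weight G x) n) |L|δ≤ε ⟩
        seq (weight G x) n ℚ.+ ε                   ∎
        where
        open ℚₚ.≤-Reasoning
        xₙ : Subset (v G) → ℚ
        xₙ I = seq (x I) n
        |L|δ≤ε : ι (length L) ℚ.* δ ℚ.≤ ε
        |L|δ≤ε = subst (ι (length L) ℚ.* δ ℚ.≤_) eq
          (ℚₚ.*-monoʳ-≤-nonNeg δ {{ℚ.nonNegative (ℚₚ.<⇒≤ 0<δ)}} (ι-mono (ℕₚ.n≤1+n (length L))))
        covers : ∀ u → 1ℚ ℚ.≤ ∑ℚ (containing G u) (λ I → xₙ I ℚ.+ δ)
        covers u = begin
          1ℚ                                                            ≤⟨ coversₙ (∈-allFin u) ⟩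
          seq (∑ (containing G u) x) n ℚ.+ δ                            ≡⟨ cong (ℚ._+ δ) (seq-∑ (containing G u) x n) ⟩
          -- The singleton of `u` is one of the sets summed over, so shifting every entry by δ makes
          -- up for the missing δ.
          ∑ℚ (containing G u) xₙ ℚ.+ δ                                  ≤⟨ ℚₚ.+-monoʳ-≤ (∑ℚ (containing G u) xₙ)
                                                                             (∈⇒≤∑ℚ (containing G u) (λ _ → ℚₚ.<⇒≤ 0<δ) (⁅u⁆∈containing G u)) ⟩
          ∑ℚ (containing G u) xₙ ℚ.+ ∑ℚ (containing G u) (λ _ → δ)      ≡⟨ ∑ℚ-shift (containing G u) xₙ δ ⟨
          ∑ℚ (containing G u) (λ I → xₙ I ℚ.+ δ)                        ∎

  ∃-fractionalChromaticNumber : ∀ {k} → FractionalClique k G →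
    ∃[ c ] (ι k ℚ.≤ c × IsFractionalChromaticNumber G (fromℚ c))
  ∃-fractionalChromaticNumber clique = optimal (∃-optimal-colouring G)
    where
    optimal : ∃[ x ] (RationalColouring G x × (∀ {x′} → RationalColouring G x′ → ∑ℚ L x ℚ.≤ ∑ℚ L x′)) → _
    optimal (x , colouring , least) = ∑ℚ L x , weak-duality clique colouring ,
      ((λ I → fromℚ (x I)) ,
       ((λ I ind → fromℚ-mono (nonNeg (∈-independentSets G ind))) ,
        λ u ε 0<ε → 0 , λ n _ → subst (λ z → 1ℚ ℚ.≤ z ℚ.+ ε) (sym (seq-∑ (containing G u) _ n))
          (proj₂ (fromℚ-mono (covers u) ε 0<ε) n z≤n)) ,
       (λ ε 0<ε → 0 , λ n _ → subst (λ z → z ℚ.≤ ∑ℚ L x ℚ.+ ε) (sym (seq-∑ L _ n))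
          (proj₂ (fromℚ-mono ℚₚ.≤-refl ε 0<ε) n z≤n)) ,
       (λ ε 0<ε → 0 , λ n _ → subst (λ z → ∑ℚ L x ℚ.≤ z ℚ.+ ε) (sym (seq-∑ L _ n))
          (proj₂ (fromℚ-mono ℚₚ.≤-refl ε 0<ε) n z≤n))) ,
      optimal-among-reals least
      where open RationalColouring colouring

-- Hall ratios

-- Stated for a relation so that it applies to an injection and to its partial inverse alike; both
-- occur in `pullback-bound`.
injective-relation⇒∣∣≤ : ∀ {a b} (A : Subset a) {B : Subset b} (R : Fin a → Fin b → Set) →
  (∀ {x} → x ∈ A → ∃[ y ] (y ∈ B × R x y)) → (∀ {x x′ y} → R x y → R x′ y → x ≡ x′) → ∣ A ∣ ℕ.≤ ∣ B ∣
injective-relation⇒∣∣≤ []          R total inj = z≤n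
injective-relation⇒∣∣≤ (false ∷ A) R total inj =
  injective-relation⇒∣∣≤ A (R ∘ suc) (total ∘ Vec.there) (λ r r′ → Finₚ.suc-injective (inj r r′))
injective-relation⇒∣∣≤ (true ∷ A) {B} R total inj with y , y∈B , r₀ ← total Vec.here = ℕₚ.≤-<-trans
  (injective-relation⇒∣∣≤ A (R ∘ suc) total′ (λ r r′ → Finₚ.suc-injective (inj r r′)))
  (x∈p⇒∣p-x∣<∣p∣ y∈B)
  where
  total′ : ∀ {x} → x ∈ A → ∃[ z ] (z ∈ (B - y) × R (suc x) z)
  total′ x∈A with z , z∈B , r ← total (Vec.there x∈A) =
    z , x∈p∧x≢y⇒x∈p-y z∈B (λ { refl → Finₚ.0≢1+n (inj r₀ r) }) , r

allVecs : ∀ {A : Set} → List A → ∀ n → List (Vec A n)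
allVecs xs zero    = [] ∷ []
allVecs xs (suc n) = cartesianProductWith _∷_ xs (allVecs xs n)

∈-allVecs : ∀ {A : Set} {xs : List A} → (∀ a → a ∈ᴸ xs) → ∀ {n} (as : Vec A n) → as ∈ᴸ allVecs xs n
∈-allVecs all∈ []       = here refl
∈-allVecs all∈ (a ∷ as) = ∈-cartesianProductWith⁺ _∷_ (all∈ a) (∈-allVecs all∈ as)

∃-maximum : ∀ {A : Set} (xs : List A) (f : A → ℚ) {a} → a ∈ᴸ xs →
  ∃[ m ] (m ∈ᴸ xs × (∀ {b} → b ∈ᴸ xs → f b ℚ.≤ f m))
∃-maximum (x ∷ []) f _ = x , here refl , λ { (here refl) → ℚₚ.≤-refl }
∃-maximum (x ∷ xs@(_ ∷ _)) f _ with m , m∈ , f≤ ← ∃-maximum xs f (here refl) with ℚₚ.≤-total (f x) (f m)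
... | inj₁ fx≤fm = m , there m∈ , λ { (here refl) → fx≤fm ; (there b∈) → f≤ b∈ }
... | inj₂ fm≤fx = x , here refl , λ { (here refl) → ℚₚ.≤-refl ; (there b∈) → ℚₚ.≤-trans (f≤ b∈) fm≤fx }

pullback : (G : Graph) {n : ℕ} → (Fin n → Fin (v G)) → Graph
pullback G {n} f = record
  { v     = n
  ; _~_   = λ x y → f x ~ f y
  ; ~-sym = ~-sym
  ; ~-irr = λ { refl → ~-irr refl }
  ; _~?_  = λ x y → f x ~? f y
  }
  where open Graph G using (_~_; ~-sym; ~-irr; _~?_)

-- The pullback has all edges of `H` and possibly more. Hence, among subgraphs on given vertices,
-- the induced one has the largest v / α, and only finitely many graphs compete for the Hall ratio.
α-pullback-≤ : ∀ G H (f : Fin (v H) → Fin (v G)) →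
  (∀ {x y} → Graph._~_ H x y → Graph._~_ G (f x) (f y)) → α (pullback G f) ℕ.≤ α H
α-pullback-≤ G H f edges = max≤v⁺ z≤n (Allₚ.map⁺ (All.tabulate λ {S} S∈ →
  ∣independent∣≤α H λ x y x∈ y∈ x~y → independentSets⁻ (pullback G f) S∈ x y x∈ y∈ (edges x~y)))

pullback-bound : ∀ {r} G → (∀ T → IndependentPart r G T) →
  ∀ {n} (f : Fin n → Fin (v G)) → Injective _≡_ _≡_ f → n ℕ.≤ r ℕ.* α (pullback G f)
pullback-bound {r} G parts {n} f inj = bound (parts image)
  where
  image : Subset (v G)
  image = Vec.tabulate λ u → does (any? λ x → f x Finₚ.≟ u)

  image⁺ : ∀ x → f x ∈ image
  image⁺ x = lookup⇒[]= (f x) image (trans (lookup∘tabulate _ (f x)) (dec-true (any? λ z → f z Finₚ.≟ f x) (x , refl)))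

  image⁻ : ∀ {u} → u ∈ image → ∃[ x ] (f x ≡ u)
  image⁻ {u} u∈ with any? (λ x → f x Finₚ.≟ u) | trans (sym (lookup∘tabulate (λ u → does (any? λ x → f x Finₚ.≟ u)) u)) ([]=⇒lookup u∈)
  ... | yes found | _ = found

  n≤∣image∣ : n ℕ.≤ ∣ image ∣
  n≤∣image∣ = subst (ℕ._≤ ∣ image ∣) (∣⊤∣≡n n) (injective-relation⇒∣∣≤ ⊤ (λ x u → f x ≡ u)
    (λ {x} _ → f x , image⁺ x , refl) (λ eq eq′ → inj (trans eq (sym eq′))))

  bound : IndependentPart r G image → n ℕ.≤ r ℕ.* α (pullback G f)
  bound (part {set = I} I⊑ ind large) = begin
    n                         ≤⟨ n≤∣image∣ ⟩
    ∣ image ∣                 ≤⟨ large ⟩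
    r ℕ.* ∣ I ∣               ≤⟨ ℕₚ.*-monoʳ-≤ r (injective-relation⇒∣∣≤ I (λ u x → f x ≡ u) total (λ eq eq′ → trans (sym eq) eq′)) ⟩
    r ℕ.* ∣ J ∣               ≤⟨ ℕₚ.*-monoʳ-≤ r (∣independent∣≤α (pullback G f) λ x y x∈ y∈ → ind (f x) (f y) (J⁻ x∈) (J⁻ y∈)) ⟩
    r ℕ.* α (pullback G f)    ∎
    where
    open ℕₚ.≤-Reasoning
    J : Subset n
    J = Vec.tabulate (lookup I ∘ f)
    J⁻ : ∀ {x} → x ∈ J → f x ∈ I
    J⁻ {x} x∈ = lookup⇒[]= (f x) I (trans (sym (lookup∘tabulate _ x)) ([]=⇒lookup x∈))
    total : ∀ {u} → u ∈ I → ∃[ x ] (x ∈ J × f x ≡ u)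
    total u∈ with x , refl ← image⁻ (I⊑ u∈) =
      x , lookup⇒[]= x J (trans (lookup∘tabulate _ x) ([]=⇒lookup u∈)) , refl

v/α-mono : ∀ H K .{{_ : ℕ.NonZero (v H)}} .{{_ : ℕ.NonZero (v K)}} →
  v H ≡ v K → α K ℕ.≤ α H → v/α H ℚ.≤ v/α K
v/α-mono H K v≡v αK≤αH = /-mono (v H) (α H) (v K) (α K) {{α-nonZero H}} {{α-nonZero K}}
  (ℕₚ.*-mono-≤ (ℕₚ.≤-reflexive v≡v) αK≤αH)

v/α≤ι : ∀ H .{{_ : ℕ.NonZero (v H)}} r → v H ℕ.≤ r ℕ.* α H → v/α H ℚ.≤ ι r
v/α≤ι H r v≤rα = /-mono (v H) (α H) r 1 {{α-nonZero H}}
  (subst (ℕ._≤ r ℕ.* α H) (sym (ℕₚ.*-identityʳ (v H))) v≤rα)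

module _ (G : Graph) where
  private
    -- A nonempty sequence of vertices; an injective one spans an induced subgraph. Vectors are used
    -- in place of functions because they can be listed.
    Candidate : Set
    Candidate = ∃[ n ] Vec (Fin (v G)) (suc n)

    graph : Candidate → Graph
    graph c = pullback G (lookup (proj₂ c))

    InjectiveVec : Candidate → Set
    InjectiveVec (_ , f) = ∀ x y → lookup f x ≡ lookup f y → x ≡ y

    injective? : ∀ c → Dec (InjectiveVec c)
    injective? (_ , f) = all? λ x → all? λ y → (lookup f x Finₚ.≟ lookup f y) →-dec (x Finₚ.≟ y)

    candidates : List Candidate
    candidates = filter injective? (concatMap (λ n → map (n ,_) (allVecs (allFin (v G)) (suc n))) (upTo (v G)))

    ∈-candidates : ∀ {n} (f : Fin (suc n) → Fin (v G)) → Injective _≡_ _≡_ f → (n , Vec.tabulate f) ∈ᴸ candidates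
    ∈-candidates {n} f inj = ∈-filter⁺ injective?
      (∈-concatMap⁺ _ (lose (∈-upTo⁺ (injective⇒≤ inj)) (∈-map⁺ (n ,_) (∈-allVecs ∈-allFin (Vec.tabulate f)))))
      (λ x y eq → inj (trans (sym (lookup∘tabulate f x)) (trans eq (lookup∘tabulate f y))))

    ratio-maximal : ∀ {c} → (∀ {d} → d ∈ᴸ candidates → v/α (graph d) ℚ.≤ v/α (graph c)) →
      ∀ H .{{_ : ℕ.NonZero (v H)}} → H ⊆ G → v/α H ℚ.≤ v/α (graph c)
    ratio-maximal {c} largest H@record { v = suc n } H⊆G = ℚₚ.≤-trans
      {j = v/α (graph d)}
      (v/α-mono H (graph d) refl α≤)
      (largest {d} (∈-candidates embed injective))
      where
      open _⊆_ H⊆G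
      d : Candidate
      d = n , Vec.tabulate embed
      α≤ : α (graph d) ℕ.≤ α H
      α≤ = α-pullback-≤ G H (lookup (Vec.tabulate embed)) λ {x} {y} x~y →
        subst₂ (Graph._~_ G) (sym (lookup∘tabulate embed x)) (sym (lookup∘tabulate embed y)) (edges x~y)

  ∃-hallRatio : ∀ {r} → Fin (v G) → (∀ T → IndependentPart r G T) → ∃[ ρ ] (IsHallRatio G ρ × ρ ℚ.≤ ι r)
  ∃-hallRatio {r} u parts = conclude (∃-maximum candidates (λ c → v/α (graph c))
    (∈-candidates {0} (λ _ → u) λ { {Fin.zero} {Fin.zero} _ → refl }))
    where
    conclude : ∃[ c ] (c ∈ᴸ candidates × (∀ {d} → d ∈ᴸ candidates → v/α (graph d) ℚ.≤ v/α (graph c))) →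
      ∃[ ρ ] (IsHallRatio G ρ × ρ ℚ.≤ ι r)
    conclude (c , c∈ , largest) = v/α (graph c) , isHallRatio ,
      v/α≤ι (graph c) r (pullback-bound G parts (lookup (proj₂ c)) λ {x} {y} → inj x y)
      where
      inj : InjectiveVec c
      inj = proj₂ (∈-filter⁻ injective? {xs = concatMap _ (upTo (v G))} c∈)

      graph⊆G : graph c ⊆ G
      graph⊆G = record { embed = lookup (proj₂ c) ; injective = λ {x} {y} → inj x y ; edges = id }

      isHallRatio : IsHallRatio G (v/α (graph c))
      isHallRatio = record
        { attained = graph c , _ , graph⊆G , refl {x = v/α (graph c)}
        ; maximal  = ratio-maximal {c} (λ {d} → largest {d})
        }

-- The Hall ratio is defined only for graphs with a vertex. Without vertices the total weight would
-- be 0, below `suc k`.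
clique-vertex : ∀ G {k} → FractionalClique (suc k) G → Fin (v G)
clique-vertex record { v = suc _ } _ = zero
clique-vertex record { v = zero } {k} clique = ⊥-elim (ℚₚ.<-irrefl refl (ℚₚ.<-≤-trans (ℚₚ.positive⁻¹ 1ℚ)
  (ℚₚ.≤-trans (ι-mono {1} {suc k} (s≤s z≤n)) (FractionalClique.total clique))))

-- Choosing k for a given real P

≤ι : ∀ q → ∃[ n ] (q ℚ.≤ ι n)
≤ι q@(mkℚ (ℤ.+ n) d _) = n , subst (ℚ._≤ ι n) (ℚₚ.↥p/↧p≡p q) (/-mono n (suc d) n 1 (ℕₚ.*-monoʳ-≤ n (s≤s z≤n)))
≤ι (mkℚ ℤ.-[1+ _ ] _ _) = 0 , ℚₚ.<⇒≤ (ℚₚ.negative⁻¹ _)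

-- This is 3k + 1, written so as to agree definitionally with the bound of `∃-join-of` at m = k.
hallBound : ℕ → ℕ
hallBound k = k ℕ.* 2 ℕ.+ suc k

hallBound-suc : ∀ k → hallBound k ℕ.+ 3 ≡ hallBound (suc k)
hallBound-suc = shape
  where
  shape : ∀ k → k ℕ.* 2 ℕ.+ suc k ℕ.+ 3 ≡ suc k ℕ.* 2 ℕ.+ suc (suc k)
  shape = solve-∀

-- The thresholds are 3 apart; descend from one above `q` until the next lower one no longer exceeds
-- it.
bracket : ∀ {q} k → ι (hallBound k) ℚ.≤ q → ∀ n → q ℚ.≤ ι (hallBound (k ℕ.+ n)) →
  ∃[ j ] (ι (hallBound (k ℕ.+ j)) ℚ.≤ q × q ℚ.≤ ι (hallBound (k ℕ.+ j) ℕ.+ 3))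
bracket {q} k hₖ≤q zero    q≤h = 0 , subst (λ i → ι (hallBound i) ℚ.≤ q) (sym (ℕₚ.+-identityʳ k)) hₖ≤q ,
  ℚₚ.≤-trans q≤h (ι-mono (ℕₚ.m≤m+n (hallBound (k ℕ.+ 0)) 3))
bracket {q} k hₖ≤q (suc n) q≤h with q ℚₚ.≤? ι (hallBound (k ℕ.+ n))
... | yes q≤hₙ = bracket k hₖ≤q n q≤hₙ
... | no  q≰hₙ = n , ℚₚ.<⇒≤ (ℚₚ.≰⇒> q≰hₙ) , subst (λ i → q ℚ.≤ ι i)
  (trans (cong hallBound (ℕₚ.+-suc k n)) (sym (hallBound-suc (k ℕ.+ n)))) q≤h

n≤hallBound : ∀ k n → n ℕ.≤ hallBound (k ℕ.+ n)
n≤hallBound k n = ℕₚ.≤-trans (ℕₚ.m≤n+m n k) (ℕₚ.≤-trans (ℕₚ.n≤1+n _) (ℕₚ.m≤n+m (suc (k ℕ.+ n)) ((k ℕ.+ n) ℕ.* 2)))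

square-mono : ∀ {p q} → 0ℚ ℚ.≤ p → p ℚ.≤ q → p ℚ.* p ℚ.≤ q ℚ.* q
square-mono {p} {q} 0≤p p≤q = ℚₚ.≤-trans
  (ℚₚ.*-monoˡ-≤-nonNeg p {{ℚ.nonNegative 0≤p}} p≤q)
  (ℚₚ.*-monoʳ-≤-nonNeg q {{ℚ.nonNegative (ℚₚ.≤-trans 0≤p p≤q)}} p≤q)

-- With K = 3 + k, the bound on p is 3K + 6, and (3K + 6)² / 33 + 1 ≤ K².
square-gap : ∀ k {p} → 0ℚ ℚ.≤ p → p ℚ.≤ ι (hallBound (3 ℕ.+ k) ℕ.+ 5) →
  p ℚ.* p ℚ.* (ℤ.+ 1 ℚ./ 33) ℚ.+ 1ℚ ℚ.≤ ι ((3 ℕ.+ k) ℕ.* (3 ℕ.+ k))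
square-gap k {p} 0≤p p≤l = begin
  p ℚ.* p ℚ.* (ℤ.+ 1 ℚ./ 33) ℚ.+ 1ℚ
    ≤⟨ ℚₚ.+-monoˡ-≤ 1ℚ (ℚₚ.*-monoʳ-≤-nonNeg (ℤ.+ 1 ℚ./ 33) (square-mono 0≤p p≤l)) ⟩
  ι l ℚ.* ι l ℚ.* (ℤ.+ 1 ℚ./ 33) ℚ.+ 1ℚ
    ≡⟨ cong (λ z → z ℚ.* (ℤ.+ 1 ℚ./ 33) ℚ.+ 1ℚ) (ι-* l l) ⟨
  ι (l ℕ.* l) ℚ.* (ℤ.+ 1 ℚ./ 33) ℚ.+ 1ℚ
    ≡⟨ cong (ℚ._+ 1ℚ) (ι*/ (l ℕ.* l) 1 33) ⟩
  ℤ.+ (l ℕ.* l ℕ.* 1) ℚ./ 33 ℚ.+ 1ℚ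
    ≤⟨ ℚₚ.+-monoˡ-≤ 1ℚ (/-mono (l ℕ.* l ℕ.* 1) 33 z 1 (ℕₚ.≤-trans (ℕₚ.m≤m+n _ _) (ℕₚ.≤-reflexive (gap k)))) ⟩
  ι z ℚ.+ 1ℚ
    ≡⟨ ι-+ z 1 ⟨
  ι (z ℕ.+ 1)
    ≡⟨ cong ι (z+1 k) ⟩
  ι ((3 ℕ.+ k) ℕ.* (3 ℕ.+ k)) ∎
  where
  open ℚₚ.≤-Reasoning
  l = hallBound (3 ℕ.+ k) ℕ.+ 5
  -- This is K² - 1; the remaining 1 becomes the positive gap that `_<_` demands. The estimate holds
  -- from K = 3 on: for K = 2 already 12² / 33 exceeds 4.
  z = k ℕ.* k ℕ.+ 6 ℕ.* k ℕ.+ 8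
  gap : ∀ k → ((3 ℕ.+ k) ℕ.* 2 ℕ.+ suc (3 ℕ.+ k) ℕ.+ 5) ℕ.* ((3 ℕ.+ k) ℕ.* 2 ℕ.+ suc (3 ℕ.+ k) ℕ.+ 5) ℕ.* 1 ℕ.* 1 ℕ.+ (24 ℕ.* (k ℕ.* k) ℕ.+ 108 ℕ.* k ℕ.+ 39) ≡
    (k ℕ.* k ℕ.+ 6 ℕ.* k ℕ.+ 8) ℕ.* 33
  gap = solve-∀
  z+1 : ∀ k → k ℕ.* k ℕ.+ 6 ℕ.* k ℕ.+ 8 ℕ.+ 1 ≡ (3 ℕ.+ k) ℕ.* (3 ℕ.+ k)
  z+1 = solve-∀

-- Comparing a real number with the thresholds is undecidable, so `k` is chosen from a rational `q`
-- that stays below the tail of `P` by at most 2.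
eventually-near : ∀ P → ∃[ q ] Eventually (λ n → q ℚ.≤ seq P n × seq P n ℚ.≤ q ℚ.+ ι 2)
eventually-near P = near (cauchy P 1ℚ (ℚₚ.positive⁻¹ 1ℚ))
  where
  near : EventuallyWithin (seq P) 1ℚ → ∃[ q ] Eventually (λ n → q ℚ.≤ seq P n × seq P n ℚ.≤ q ℚ.+ ι 2)
  near (N , close) = seq P N ℚ.- 1ℚ , N , λ n N≤n →
    subst (seq P N ℚ.- 1ℚ ℚ.≤_) (shape₁ (seq P N) (seq P n)) (ℚₚ.+-monoʳ-≤ (seq P N) (lower n N≤n)) ,
    subst₂ ℚ._≤_ (shape₂ (seq P n) (seq P N)) (shape₃ (seq P N)) (ℚₚ.+-monoˡ-≤ (seq P N) (upper n N≤n))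
    where
    open +-*-Solver
    shape₁ : ∀ a b → a ℚ.+ (b ℚ.- a) ≡ b
    shape₁ = solve 2 (λ a b → a :+ (b :- a) := b) refl
    shape₂ : ∀ b a → (b ℚ.- a) ℚ.+ a ≡ b
    shape₂ = solve 2 (λ b a → (b :- a) :+ a := b) refl
    shape₃ : ∀ a → 1ℚ ℚ.+ a ≡ a ℚ.- 1ℚ ℚ.+ ι 2
    shape₃ = solve 1 (λ a → con 1ℚ :+ a := a :- con 1ℚ :+ con (ι 2)) refl
    p≤∣p∣ : ∀ p → p ℚ.≤ ℚ.∣ p ∣
    p≤∣p∣ p with ℚₚ.≤-total 0ℚ p
    ... | inj₁ 0≤p = ℚₚ.≤-reflexive (sym (ℚₚ.0≤p⇒∣p∣≡p 0≤p))
    ... | inj₂ p≤0 = ℚₚ.≤-trans p≤0 (ℚₚ.0≤∣p∣ p)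
    upper : ∀ n → N ℕ.≤ n → seq P n ℚ.- seq P N ℚ.≤ 1ℚ
    upper n N≤n = ℚₚ.≤-trans (p≤∣p∣ _) (close n N N≤n ℕₚ.≤-refl)
    lower : ∀ n → N ℕ.≤ n → ℚ.- 1ℚ ℚ.≤ seq P n ℚ.- seq P N
    lower n N≤n = subst (ℚ.- 1ℚ ℚ.≤_) (shape₄ (seq P N) (seq P n))
      (ℚₚ.neg-antimono-≤ (ℚₚ.≤-trans (p≤∣p∣ _) (close N n ℕₚ.≤-refl N≤n)))
      where
      shape₄ : ∀ a b → ℚ.- (a ℚ.- b) ≡ b ℚ.- a
      shape₄ = solve 2 (λ a b → :- (a :- b) := b :- a) refl

∃-graph : ∀ k .{{_ : ℕ.NonZero k}} → ∃[ G ] ∃[ ρ ] ∃[ c ]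
  (IsHallRatio G ρ × IsFractionalChromaticNumber G (fromℚ c) × ρ ℚ.≤ ι (hallBound k) × ι (k ℕ.* k) ℚ.≤ c)
∃-graph k@(suc _) = build (∃-join-of k k)
  where
  build : ∃[ G ] ((∀ T → IndependentPart (hallBound k) G T) × FractionalClique (k ℕ.* k) G) → _
  build (G , parts , clique) = combine (∃-hallRatio G (clique-vertex G clique) parts) (∃-fractionalChromaticNumber G clique)
    where
    combine : ∃[ ρ ] (IsHallRatio G ρ × ρ ℚ.≤ ι (hallBound k)) →
      ∃[ c ] (ι (k ℕ.* k) ℚ.≤ c × IsFractionalChromaticNumber G (fromℚ c)) → _
    combine (ρ , isρ , ρ≤) (c , ≤c , isc) = G , ρ , c , isρ , isc , ρ≤ , ≤c

theorem2 : ∃[ P₀ ] ((P : ℝ) → P₀ ≤ P →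
    ∃[ G ] ∃[ ρ ] ∃[ χf ]
    (IsHallRatio G ρ × IsFractionalChromaticNumber G χf ×
    fromℚ ρ ≤ P × P ² / 33 < χf))
-- The constant is 10 + 2 + 1: the threshold 10 at k = 3, the error 2 of `q`, and 1 for the ε in P₀
-- ≤ P.
theorem2 = fromℚ (ι 13) , λ P P₀≤P → near P (P₀≤P 1ℚ (ℚₚ.positive⁻¹ 1ℚ)) (eventually-near P)
  where
  Conclusion : ℝ → Set₁
  Conclusion P = ∃[ G ] ∃[ ρ ] ∃[ χf ]
    (IsHallRatio G ρ × IsFractionalChromaticNumber G χf × fromℚ ρ ≤ P × P ² / 33 < χf)

  conclude : ∀ P {q} → Eventually (λ n → q ℚ.≤ seq P n × seq P n ℚ.≤ q ℚ.+ ι 2) → ∀ k →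
    ι (hallBound (3 ℕ.+ k)) ℚ.≤ q → q ℚ.≤ ι (hallBound (3 ℕ.+ k) ℕ.+ 3) →
    ∃[ G ] ∃[ ρ ] ∃[ c ] (IsHallRatio G ρ × IsFractionalChromaticNumber G (fromℚ c) ×
      ρ ℚ.≤ ι (hallBound (3 ℕ.+ k)) × ι ((3 ℕ.+ k) ℕ.* (3 ℕ.+ k)) ℚ.≤ c) → Conclusion P
  conclude P {q} (N , close) k h≤q q≤h (G , ρ , c , isρ , isc , ρ≤h , k²≤c) = G , ρ , fromℚ c , isρ , isc ,
    (λ ε 0<ε → N , λ n N≤n → ℚₚ.≤-trans (ℚₚ.≤-trans ρ≤h (ℚₚ.≤-trans h≤q (proj₁ (close n N≤n))))
      (subst (ℚ._≤ seq P n ℚ.+ ε) (ℚₚ.+-identityʳ (seq P n)) (ℚₚ.+-monoʳ-≤ (seq P n) (ℚₚ.<⇒≤ 0<ε)))) ,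
    1ℚ , ℚₚ.positive⁻¹ 1ℚ , N , λ n N≤n → ℚₚ.≤-trans
      (square-gap k (ℚₚ.≤-trans (0≤ι (hallBound (3 ℕ.+ k))) (ℚₚ.≤-trans h≤q (proj₁ (close n N≤n))))
        (ℚₚ.≤-trans (proj₂ (close n N≤n)) q+2≤))
      k²≤c
    where
    h = hallBound (3 ℕ.+ k)
    -- Here 5 is the spacing 3 of the thresholds plus the error 2 of `q`; with h = 3K + 1 this is
    -- the 3K + 6 of `square-gap`.
    q+2≤ : q ℚ.+ ι 2 ℚ.≤ ι (h ℕ.+ 5)
    q+2≤ = subst (q ℚ.+ ι 2 ℚ.≤_) (trans (sym (ι-+ (h ℕ.+ 3) 2)) (cong ι (ℕₚ.+-assoc h 3 2))) (ℚₚ.+-monoˡ-≤ (ι 2) q≤h)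

  near : ∀ P → Eventually (λ n → ι 13 ℚ.≤ seq P n ℚ.+ 1ℚ) →
    ∃[ q ] Eventually (λ n → q ℚ.≤ seq P n × seq P n ℚ.≤ q ℚ.+ ι 2) → Conclusion P
  near P (M , large) (q , N , close) = select (≤ι q)
    where
    n = M ℕ.⊔ N
    10≤q : ι (hallBound 3) ℚ.≤ q
    10≤q = subst₂ ℚ._≤_ refl (shape q) (ℚₚ.+-monoˡ-≤ (ℚ.- ι 3) (ℚₚ.≤-trans (large n (ℕₚ.m≤m⊔n M N))
      (ℚₚ.+-monoˡ-≤ 1ℚ (proj₂ (close n (ℕₚ.m≤n⊔m M N))))))
      where
      open +-*-Solver
      shape : ∀ q → q ℚ.+ ι 2 ℚ.+ 1ℚ ℚ.+ (ℚ.- ι 3) ≡ q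
      shape = solve 1 (λ q → q :+ con (ι 2) :+ con 1ℚ :+ con (ℚ.- ι 3) := q) refl

    select : ∃[ m ] (q ℚ.≤ ι m) → Conclusion P
    select (m , q≤m) = found (bracket 3 10≤q m (ℚₚ.≤-trans q≤m (ι-mono (n≤hallBound 3 m))))
      where
      found : ∃[ k ] (ι (hallBound (3 ℕ.+ k)) ℚ.≤ q × q ℚ.≤ ι (hallBound (3 ℕ.+ k) ℕ.+ 3)) → Conclusion P
      found (k , h≤q , q≤h) = conclude P (N , close) k h≤q q≤h (∃-graph (3 ℕ.+ k))
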